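{- Let $G=(V,E,\Sigma,\lambda)$ be a labeled directed graph and $\mathcal{G}=(N,\Sigma,P,S)$ a context-free grammar over the same alphabet, and let SWDIndex be built on top of a witness-producing reachability index (SatIndex or LinIndex) for $(G,\mathcal{G})$, as defined in the context. Let $T$ be the number of true entries across all matrices $M_A$, $A\in N$. Then SWDIndex uses $O(T)$ root pointers plus $O(W)$ DAG nodes, where $W\le O(T)$ and each node is created at most once by hash-consing. It supports: (i) explicit witness path extraction in time linear in the output length; and (ii) output of the compressed trace of the witness, as a straight-line program, in time $O(|D_r|)$, where $D_r$ is the sub-DAG reachable from the returned root $r$ and $|D_r|$ is its size.
   Context: A labeled directed graph is $G=(V,E,\Sigma,\lambda)$ with $V$ finite, $E\subseteq V\times V$, $\Sigma$ a finite alphabet, and $\lambda:E\to\Sigma$. The trace of a path $(v_0,v_1)\cdots(v_{k-1},v_k)$ is $\lambda(v_0,v_1)\cdots\lambda(v_{k-1},v_k)\in\Sigma^*$. For a context-free grammar $\mathcal{G}=(N,\Sigma,P,S)$ and $A\in N$, $\mathcal{L}_{\mathcal{G}}(A)$ is the language generated from $A$, and $\mathcal{R}_A$ is the set of $(u,v)\in V\times V$ such that some path from $u$ to $v$ has trace in $\mathcal{L}_{\mathcal{G}}(A)$. The underlying indices store Boolean matrices $M_A$ encoding $\mathcal{R}_A$ ($A\in N$) and, for each true entry $M_A[u,v]=1$, one witness record $W[A,u,v]$, written once when the entry is first set to true. SatIndex (grammar in Chomsky normal form: $A\to BC$, $A\to a$, optionally $S\to\varepsilon$) and LinIndex (grammar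 with productions $A\to a$, $A\to aB$, $A\to Ba$, and optionally $S\to\varepsilon$) are obtained by worklist saturation: entries are inserted one at a time, and a record refers only to entries already inserted. The records for an entry $(A,u,v)$ are: $\langle\mathsf{term},(u,v)\rangle$ (rule $A\to a$ used with the edge $(u,v)$ labeled $a$); $\langle\mathsf{eps}\rangle$ (rule $S\to\varepsilon$, $A=S$, $u=v$); in SatIndex, $\langle\mathsf{bin},B,C,x\rangle$ (rule $A\to BC$; a witness for $(B,u,x)$ followed by a witness for $(C,x,v)$); in LinIndex, $\langle\mathsf{linL},a,(u,x),B\rangle$ (rule $A\to aB$; the $a$-labeled edge $(u,x)$ followed by a witness for $(B,x,v)$) and $\langle\mathsf{linR},B,a,(x,v)\rangle$ (rule $A\to Ba$; a witness for $(B,u,x)$ followed by the $a$-labeled edge $(x,v)$). A witness DAG is a rooted DAG whose nodes are of three kinds: $\mathsf{Edge}(u,v)$, denoting the single-edge path $(u,v)$; $\mathsf{Eps}(u)$, denoting the empty path at $u$; and $\mathsf{Concat}(p,q)$ with $p,q$ witness nodes, denoting the concatenation of the paths denoted by $p$ and $q$. SWDIndex replaces the per-entry witness records of the underlying index by pointers (root pointers, one per true entry) into a hash-consed global witness DAG, built with these constructors and sharing identical subwitnesses: hash-consing means that a constructor applied to the same arguments is materialized at most once. A query returns a pointer to a DAG root $r$. $W$ in the claim denotes the number of nodes of this shared DAG. A straight-line program (SLP) for a string is an acyclic context-free grammar with exactly one production per nonterminal that generates exactly that string.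
   Formalization: In (i) time is at most d·(1 + path length); d is absolute for LinIndex and when S occurs in no rule A→BC in the presence of S→ε. Otherwise, for SatIndex, d may depend on the grammar, since chains of empty subwitnesses make an absolute constant impossible. -}

module Defs where

open import Data.Bool using (Bool; true; false; T; if_then_else_)
open import Data.Fin using (Fin; toℕ)
import Data.Fin as Fin
open import Data.List using (List; []; _∷_; _++_; _∷ʳ_; [_]; length; map; head; drop; concatMap; filterᵇ; allFin; cartesianProduct; sum)
open import Data.List.Membership.Propositional using (_∈_)
import Data.List.Membership.DecPropositional as DecMembership
open import Data.List.Relation.Binary.Permutation.Propositional using (_↭_)
open import Data.List.Relation.Unary.All using (All)
open import Data.List.Relation.Unary.Any using (index)
open import Data.List.Relation.Unary.Unique.Propositional using (Unique)
open import Data.Maybe using (Maybe; just; nothing; is-just; to-witness-T)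
open import Data.Nat using (ℕ; zero; suc; pred; _+_; _<ᵇ_; _≡ᵇ_)
import Data.Nat as ℕ
open import Data.Product using (Σ-syntax; ∃-syntax; _×_; _,_; proj₁)
open import Data.Product.Properties using (≡-dec)
open import Data.Sum using (_⊎_; inj₁; inj₂)
open import Function using (_∘_; _⇔_)
open import Relation.Binary using (DecidableEquality)
open import Relation.Binary.Construct.Closure.ReflexiveTransitive using (Star)
open import Relation.Binary.Construct.Closure.Transitive using (TransClosure)
open import Relation.Binary.PropositionalEquality using (_≡_; _≢_; refl; subst)
open import Relation.Nullary using (¬_; Dec; yes; no; does)

infix 20 _at_

_at_ : {A : Set} → List A → ℕ → Maybe A
xs at i = head (drop i xs)

-- E is the set of pairs on which `arc` is defined, and λ is its value there.
record Graph (σ : ℕ) : Set where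
  field
    #V  : ℕ
    arc : Fin #V → Fin #V → Maybe (Fin σ)

  V : Set
  V = Fin #V

open Graph public

-- Path G u v π w : the edge sequence π is a path from u to v with trace w.
data Path {σ} (G : Graph σ) : V G → V G → List (V G × V G) → List (Fin σ) → Set where
  []   : ∀ {u} → Path G u u [] []
  step : ∀ {u x v a π w} → arc G u x ≡ just a → Path G x v π w →
         Path G u v ((u , x) ∷ π) (a ∷ w)

record CFG (σ : ℕ) : Set where
  field
    #N    : ℕ
    start : Fin #N
    P     : List (Fin #N × List (Fin #N ⊎ Fin σ))

  N : Set
  N = Fin #N

  Sym : Set
  Sym = N ⊎ Fin σ

open CFG public

data Rewrites {σ} (𝒢 : CFG σ) : List (Sym 𝒢) → List (Sym 𝒢) → Set where
  rewrite-at : ∀ {A γ} α β → (A , γ) ∈ P 𝒢 →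
               Rewrites 𝒢 (α ++ inj₁ A ∷ β) (α ++ γ ++ β)

𝓛 : ∀ {σ} (𝒢 : CFG σ) → N 𝒢 → List (Fin σ) → Set
𝓛 𝒢 A w = Star (Rewrites 𝒢) [ inj₁ A ] (map inj₂ w)

𝓡 : ∀ {σ} (𝒢 : CFG σ) (G : Graph σ) → N 𝒢 → V G → V G → Set
𝓡 𝒢 G A u v = ∃[ π ] ∃[ w ] Path G u v π w × 𝓛 𝒢 A w

data Kind : Set where
  sat lin : Kind

data Rule {σ} (𝒢 : CFG σ) : Kind → N 𝒢 × List (Sym 𝒢) → Set where
  A→a  : ∀ {κ A a} → Rule 𝒢 κ (A , inj₂ a ∷ [])
  S→ε  : ∀ {κ} → Rule 𝒢 κ (start 𝒢 , [])
  A→BC : ∀ {A B C} → Rule 𝒢 sat (A , inj₁ B ∷ inj₁ C ∷ [])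
  A→aB : ∀ {A a B} → Rule 𝒢 lin (A , inj₂ a ∷ inj₁ B ∷ [])
  A→Ba : ∀ {A B a} → Rule 𝒢 lin (A , inj₁ B ∷ inj₂ a ∷ [])

NormalForm : ∀ {σ} → Kind → CFG σ → Set
NormalForm κ 𝒢 = All (Rule 𝒢 κ) (P 𝒢)

-- The usual proviso of Chomsky normal form: in the presence of S→ε, the
-- start symbol occurs in no rule A→BC.  It is not part of NormalForm.  Without
-- it a witness may contain arbitrarily many Eps leaves per edge, up to a factor
-- depending on the grammar only, so the constant of path extraction is then
-- not absolute.  (It holds vacuously for NormalForm lin.)
ε-Isolated : ∀ {σ} → CFG σ → Set
ε-Isolated 𝒢 = (start 𝒢 , []) ∈ P 𝒢 →
  ∀ A B C → (A , inj₁ B ∷ inj₁ C ∷ []) ∈ P 𝒢 → B ≢ start 𝒢 × C ≢ start 𝒢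

Entry : ∀ {σ} → CFG σ → Graph σ → Set
Entry 𝒢 G = N 𝒢 × V G × V G

_≟ₑ_ : ∀ {σ} {𝒢 : CFG σ} {G : Graph σ} → DecidableEquality (Entry 𝒢 G)
_≟ₑ_ = ≡-dec Fin._≟_ (≡-dec Fin._≟_ Fin._≟_)

entries : ∀ {σ} (𝒢 : CFG σ) (G : Graph σ) → List (Entry 𝒢 G)
entries 𝒢 G = cartesianProduct (allFin (#N 𝒢)) (cartesianProduct (allFin (#V G)) (allFin (#V G)))

data Record {σ} (𝒢 : CFG σ) (G : Graph σ) : Kind → Set where
  term : ∀ {κ} → V G × V G → Record 𝒢 G κ
  eps  : ∀ {κ} → Record 𝒢 G κ
  bin  : N 𝒢 → N 𝒢 → V G → Record 𝒢 G sat
  linL : Fin σ → V G × V G → N 𝒢 → Record 𝒢 G lin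
  linR : N 𝒢 → Fin σ → V G × V G → Record 𝒢 G lin

-- The witness array W; the Boolean matrices are M_A[u,v] = is-just (W (A , u , v)).
Table : ∀ {σ} → CFG σ → Graph σ → Kind → Set
Table 𝒢 G κ = Entry 𝒢 G → Maybe (Record 𝒢 G κ)

Inserted : ∀ {σ} {𝒢 : CFG σ} {G : Graph σ} {κ} → Table 𝒢 G κ → Entry 𝒢 G → Set
Inserted W e = T (is-just (W e))

write : ∀ {σ} {𝒢 : CFG σ} {G : Graph σ} {X : Set} →
        Entry 𝒢 G → X → (Entry 𝒢 G → Maybe X) → (Entry 𝒢 G → Maybe X)
write {𝒢 = 𝒢} {G} e x f e′ = if does (_≟ₑ_ {𝒢 = 𝒢} {G} e e′) then just x else f e′

data Justified {σ} {𝒢 : CFG σ} {G : Graph σ} :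
     ∀ {κ} → Table 𝒢 G κ → Entry 𝒢 G → Record 𝒢 G κ → Set where
  term : ∀ {κ} {W : Table 𝒢 G κ} {A a u v} →
         (A , inj₂ a ∷ []) ∈ P 𝒢 → arc G u v ≡ just a →
         Justified W (A , u , v) (term (u , v))
  eps  : ∀ {κ} {W : Table 𝒢 G κ} {u} →
         (start 𝒢 , []) ∈ P 𝒢 →
         Justified W (start 𝒢 , u , u) eps
  bin  : ∀ {W : Table 𝒢 G sat} {A B C u x v} →
         (A , inj₁ B ∷ inj₁ C ∷ []) ∈ P 𝒢 →
         Inserted W (B , u , x) → Inserted W (C , x , v) →
         Justified W (A , u , v) (bin B C x)
  linL : ∀ {W : Table 𝒢 G lin} {A a B u x v} →
         (A , inj₂ a ∷ inj₁ B ∷ []) ∈ P 𝒢 →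
         arc G u x ≡ just a → Inserted W (B , x , v) →
         Justified W (A , u , v) (linL a (u , x) B)
  linR : ∀ {W : Table 𝒢 G lin} {A a B u x v} →
         (A , inj₁ B ∷ inj₂ a ∷ []) ∈ P 𝒢 →
         Inserted W (B , u , x) → arc G x v ≡ just a →
         Justified W (A , u , v) (linR B a (x , v))

-- No insertion order is fixed: any one the worklist may produce is allowed.
data History {σ} {𝒢 : CFG σ} {G : Graph σ} {κ} : Table 𝒢 G κ → Set where
  empty  : History (λ _ → nothing)
  insert : ∀ {W e ω} → History W → W e ≡ nothing → Justified W e ω →
           History (write {𝒢 = 𝒢} {G} e ω W)

record Index {σ} (κ : Kind) (𝒢 : CFG σ) (G : Graph σ) : Set where
  field
    W       : Table 𝒢 G κ
    history : History {𝒢 = 𝒢} {G} W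

  M : N 𝒢 → V G → V G → Bool
  M A u v = is-just (W (A , u , v))

  field
    encodes : ∀ A u v → T (M A u v) ⇔ 𝓡 𝒢 G A u v

open Index public

#true : ∀ {σ κ} {𝒢 : CFG σ} {G : Graph σ} → Index κ 𝒢 G → ℕ
#true {𝒢 = 𝒢} {G} ix = length (filterᵇ (λ (A , u , v) → M ix A u v) (entries 𝒢 G))

-- Pointers are positions in a list of nodes.
data Node (n : ℕ) : Set where
  edge   : Fin n → Fin n → Node n
  eps    : Fin n → Node n
  concat : ℕ → ℕ → Node n

infix 4 _≟ₙ_

_≟ₙ_ : ∀ {n} → DecidableEquality (Node n)
edge u v ≟ₙ edge u′ v′ with u Fin.≟ u′ | v Fin.≟ v′
... | yes refl | yes refl = yes refl
... | no u≢u′  | _        = no λ { refl → u≢u′ refl }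
... | _        | no v≢v′  = no λ { refl → v≢v′ refl }
eps u ≟ₙ eps u′ with u Fin.≟ u′
... | yes refl = yes refl
... | no u≢u′  = no λ { refl → u≢u′ refl }
concat p q ≟ₙ concat p′ q′ with p ℕ.≟ p′ | q ℕ.≟ q′
... | yes refl | yes refl = yes refl
... | no p≢p′  | _        = no λ { refl → p≢p′ refl }
... | _        | no q≢q′  = no λ { refl → q≢q′ refl }
edge _ _   ≟ₙ eps _      = no λ ()
edge _ _   ≟ₙ concat _ _ = no λ ()
eps _      ≟ₙ edge _ _   = no λ ()
eps _      ≟ₙ concat _ _ = no λ ()
concat _ _ ≟ₙ edge _ _   = no λ ()
concat _ _ ≟ₙ eps _      = no λ ()

Dag : ℕ → Set
Dag n = List (Node n)

data Denotes {n} (D : Dag n) : ℕ → List (Fin n × Fin n) → Set where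
  edge   : ∀ {p u v} → D at p ≡ just (edge u v) → Denotes D p [ (u , v) ]
  eps    : ∀ {p u} → D at p ≡ just (eps u) → Denotes D p []
  concat : ∀ {p q r π ρ} → D at p ≡ just (concat q r) →
           Denotes D q π → Denotes D r ρ → Denotes D p (π ++ ρ)

data Child {n} (D : Dag n) : ℕ → ℕ → Set where
  left  : ∀ {p q r} → D at p ≡ just (concat q r) → Child D p q
  right : ∀ {p q r} → D at p ≡ just (concat q r) → Child D p r

-- The sub-DAG D_r has exactly m nodes.
SubDagSize : ∀ {n} → Dag n → ℕ → ℕ → Set
SubDagSize D r m =
  ∃[ ps ] Unique ps × (∀ q → q ∈ ps ⇔ Star (Child D) r q) × length ps ≡ m

-- Hash-consing.  Allocation is append-only, so the node list is also the log of
-- all node creations.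
cons : ∀ {n} → Dag n → Node n → Dag n × ℕ
cons D x with DecMembership._∈?_ _≟ₙ_ x D
... | yes x∈D = D , toℕ (index x∈D)
... | no  _   = D ∷ʳ x , length D

record SWD {σ} {𝒢 : CFG σ} {G : Graph σ} {κ} (W : Table 𝒢 G κ) : Set where
  field
    dag    : Dag (#V G)
    root   : Entry 𝒢 G → Maybe ℕ
    rooted : ∀ e → is-just (W e) ≡ is-just (root e)

  pointer : ∀ e → Inserted {𝒢 = 𝒢} {G} W e → ℕ
  pointer e t = to-witness-T (root e) (subst T (rooted e) t)

open SWD public

compile : ∀ {σ} {𝒢 : CFG σ} {G : Graph σ} {κ} {W : Table 𝒢 G κ} {e ω} →
          SWD {𝒢 = 𝒢} {G} W → Justified {𝒢 = 𝒢} {G} W e ω → Dag (#V G) × ℕ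
compile S (term {u = u} {v} _ _) = cons (dag S) (edge u v)
compile S (eps {u = u} _)        = cons (dag S) (eps u)
compile S (bin _ p q)            = cons (dag S) (concat (pointer S _ p) (pointer S _ q))
compile S (linL {u = u} {x} _ _ q) =
  let (D , p) = cons (dag S) (edge u x) in cons D (concat p (pointer S _ q))
compile S (linR {x = x} {v} _ p _) =
  let (D , q) = cons (dag S) (edge x v) in cons D (concat (pointer S _ p) q)

swd : ∀ {σ} {𝒢 : CFG σ} {G : Graph σ} {κ} {W : Table 𝒢 G κ} →
      History {𝒢 = 𝒢} {G} W → SWD {𝒢 = 𝒢} {G} W
swd empty = record { dag = [] ; root = λ _ → nothing ; rooted = λ _ → refl }
swd {𝒢 = 𝒢} {G} (insert {W} {e} {ω} h _ j) =
  let S       = swd h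
      (D , p) = compile S j
  in record
    { dag    = D
    ; root   = write {𝒢 = 𝒢} {G} e p (root S)
    ; rooted = λ e′ → agree (does (_≟ₑ_ {𝒢 = 𝒢} {G} e e′)) ω p (rooted S e′)
    }
  where
  agree : ∀ {X Y : Set} b (x : X) (y : Y) {m : Maybe X} {n : Maybe Y} →
          is-just m ≡ is-just n →
          is-just (if b then just x else m) ≡ is-just (if b then just y else n)
  agree true  _ _ _  = refl
  agree false _ _ eq = eq

SWDIndex : ∀ {σ κ} {𝒢 : CFG σ} {G : Graph σ} (ix : Index κ 𝒢 G) → SWD {𝒢 = 𝒢} {G} (W ix)
SWDIndex ix = swd (history ix)

#roots : ∀ {σ} {𝒢 : CFG σ} {G : Graph σ} {κ} {W : Table 𝒢 G κ} → SWD {𝒢 = 𝒢} {G} W → ℕ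
#roots {𝒢 = 𝒢} {G} S = length (filterᵇ (is-just ∘ root S) (entries 𝒢 G))

#nodes : ∀ {σ} {𝒢 : CFG σ} {G : Graph σ} {κ} {W : Table 𝒢 G κ} → SWD {𝒢 = 𝒢} {G} W → ℕ
#nodes S = length (dag S)

words : ∀ {n} → Node n → List ℕ
words (edge u v)   = 0 ∷ toℕ u ∷ toℕ v ∷ []
words (eps u)      = 1 ∷ toℕ u ∷ []
words (concat p q) = 2 ∷ p ∷ q ∷ []

space : ∀ {σ} {𝒢 : CFG σ} {G : Graph σ} {κ} {W : Table 𝒢 G κ} → SWD {𝒢 = 𝒢} {G} W → ℕ
space S = #roots S + sum (map (length ∘ words) (dag S))

-- A unit-cost random-access machine.  Registers and cells hold natural numbers,
-- and the only arithmetic is successor and predecessor, so unit cost is not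
-- exploitable.  The input is read-only; `work k` are writable arrays; the output
-- tape is write-only.

data Input : Set where
  nodes labels : Input

Reg : Set
Reg = ℕ

data Instr : Set where
  const      : Reg → ℕ → Instr               -- x := k
  copy       : Reg → Reg → Instr             -- x := y
  inc dec    : Reg → Instr
  read       : Reg → Input → Reg → Reg → Instr -- x := input[i,j]
  load       : Reg → ℕ → Reg → Instr         -- x := work k [i]
  store      : ℕ → Reg → Reg → Instr         -- work k [i] := x
  jump       : ℕ → Instr
  jump-if-<  : Reg → Reg → ℕ → Instr
  jump-if-≡  : Reg → Reg → ℕ → Instr
  emit       : Reg → Instr

Program : Set
Program = List Instr

record State : Set where
  constructor state
  field
    pc   : ℕ
    reg  : ℕ → ℕ
    work : ℕ → ℕ → ℕ
    out  : List ℕ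

_[_≔_] : {X : Set} → (ℕ → X) → ℕ → X → (ℕ → X)
(f [ i ≔ x ]) j = if i ≡ᵇ j then x else f j

exec : (Input → ℕ → ℕ → ℕ) → Instr → State → State
exec inp (const x k)       (state pc r w o) = state (suc pc) (r [ x ≔ k ]) w o
exec inp (copy x y)        (state pc r w o) = state (suc pc) (r [ x ≔ r y ]) w o
exec inp (inc x)           (state pc r w o) = state (suc pc) (r [ x ≔ suc (r x) ]) w o
exec inp (dec x)           (state pc r w o) = state (suc pc) (r [ x ≔ pred (r x) ]) w o
exec inp (read x t i j)    (state pc r w o) = state (suc pc) (r [ x ≔ inp t (r i) (r j) ]) w o
exec inp (load x k i)      (state pc r w o) = state (suc pc) (r [ x ≔ w k (r i) ]) w o
exec inp (store k i x)     (state pc r w o) = state (suc pc) r (w [ k ≔ w k [ r i ≔ r x ] ]) o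
exec inp (jump l)          (state pc r w o) = state l r w o
exec inp (jump-if-< x y l) (state pc r w o) = state (if r x <ᵇ r y then l else suc pc) r w o
exec inp (jump-if-≡ x y l) (state pc r w o) = state (if r x ≡ᵇ r y then l else suc pc) r w o
exec inp (emit x)          (state pc r w o) = state (suc pc) r w (o ∷ʳ r x)

-- Runs inp prog s t o : from s, the program halts (by leaving the program
-- text) after exactly t instructions, with output o.
data Runs (inp : Input → ℕ → ℕ → ℕ) (prog : Program) : State → ℕ → List ℕ → Set where
  halt : ∀ {s} → prog at State.pc s ≡ nothing → Runs inp prog s 0 (State.out s)
  next : ∀ {s i t o} → prog at State.pc s ≡ just i →
         Runs inp prog (exec inp i s) t o → Runs inp prog s (suc t) o

-- Register 0 receives the pointer returned by the query.
initial : ℕ → (ℕ → ℕ → ℕ) → State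
initial r scratch = state 0 ((λ _ → 0) [ 0 ≔ r ]) scratch []

-- The input holds the DAG and the edge labels; cells not mentioned are arbitrary.
record Stores {σ} (G : Graph σ) (D : Dag (#V G)) (inp : Input → ℕ → ℕ → ℕ) : Set where
  field
    dag-cells   : ∀ {p x i k} → D at p ≡ just x → words x at i ≡ just k → inp nodes p i ≡ k
    label-cells : ∀ {u v a} → arc G u v ≡ just a → inp labels (toℕ u) (toℕ v) ≡ toℕ a

-- Started on r, the program outputs `o` within `bound` instructions, whatever
-- the contents of its work arrays; in particular it may be run for one query
-- after another without re-initialising them.
Outputs : ∀ {σ} (G : Graph σ) → Dag (#V G) → Program → ℕ → ℕ → List ℕ → Set
Outputs G D prog r bound o =
  ∀ inp scratch → Stores G D inp →
  ∃[ t ] Runs inp prog (initial r scratch) t o × t ℕ.≤ bound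

encodePath : ∀ {n} → List (Fin n × Fin n) → List ℕ
encodePath = concatMap λ (u , v) → toℕ u ∷ toℕ v ∷ []

Uses : ∀ {σ} (H : CFG σ) → N H → N H → Set
Uses H X Y = ∃[ γ ] (X , γ) ∈ P H × inj₁ Y ∈ γ

record IsSLP {σ} (H : CFG σ) (w : List (Fin σ)) : Set where
  field
    one-production : map proj₁ (P H) ↭ allFin (#N H)
    acyclic        : ∀ X → ¬ TransClosure (Uses H) X X
    generates      : ∀ v → 𝓛 H (start H) v ⇔ v ≡ w

encodeSym : ∀ {σ} (H : CFG σ) → Sym H → List ℕ
encodeSym H (inj₁ X) = 0 ∷ toℕ X ∷ []
encodeSym H (inj₂ a) = 1 ∷ toℕ a ∷ []

-- The number of nonterminals of an SLP is its number of productions, so it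
-- need not be written.
encodeSLP : ∀ {σ} → CFG σ → List ℕ
encodeSLP H = toℕ (start H) ∷
  concatMap (λ (X , γ) → toℕ X ∷ length γ ∷ concatMap (encodeSym H) γ) (P H)

{-# OPTIONS --safe #-}
module Submission where

-- The unfolding of the DAG at a root is a tree of n nodes whose leaves spell the
-- witness.  Extraction traverses it with a stack in time O(n).  Compression is a
-- breadth-first search of the sub-DAG which numbers the nodes in the order of
-- discovery and turns each of them into one production; the search needs no
-- initialised memory because visits are certified by the pair queue / position
-- in the queue.  The word of a node is a valuation of nonterminals invariant
-- under rewriting, hence the grammar generates that word only.
--
-- With ε isolated, or linear rules, n ≤ 2 (|π| + 1).  In general give an entry
-- (A , u , v) as its rank the number of nonterminals inserted at (u , v) before
-- it.  A sibling denoting the empty path keeps the endpoints, so ranks strictly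
-- decrease along it: subtrees with empty path have depth at most #N, and at most
-- #N of them are attached in a row, whence n ≤ sizeFactor #N · (|π| + 1).

open import Defs
open import Data.Nat using (ℕ; suc; _+_; _*_; _≤_)
open import Data.Bool using (T)
open import Data.List using (length)
open import Data.List.Relation.Unary.Unique.Propositional using (Unique)
open import Data.Maybe using (just)
open import Data.Product using (Σ-syntax; ∃-syntax; _×_; _,_)
open import Relation.Binary.PropositionalEquality using (_≡_)

open import Data.Bool using (Bool; true; false; if_then_else_)
open import Data.Empty using (⊥-elim)
open import Data.Fin using (Fin; toℕ; fromℕ<)
import Data.Fin as Fin
open import Data.Fin.Properties using (all?; toℕ-injective; fromℕ<-injective; injective⇒≤; toℕ-fromℕ<)
open import Data.List
  using (List; []; _∷_; _++_; _∷ʳ_; [_]; map; drop; concatMap; filterᵇ; allFin; lookup; tabulate)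
import Data.List.Membership.DecPropositional as DecMembership
open import Data.List.Membership.Propositional using (_∈_; _∉_)
open import Data.List.Membership.Propositional.Properties
  using (∈-cartesianProduct⁺; ∈-allFin; ∈-lookup; ∈-++⁺ʳ; ∈-tabulate⁻; ∈-tabulate⁺)
open import Data.List.Properties
  using (map-++; ++-assoc; ++-identityʳ; ∷ʳ-++; length-++; length-filter; length-tabulate;
         map-tabulate; concatMap-++; drop-all)
import Data.List.Properties as List
open import Data.List.Relation.Binary.Permutation.Propositional using (↭-reflexive)
open import Data.List.Relation.Unary.All using (All; []; _∷_)
import Data.List.Relation.Unary.All as All
import Data.List.Relation.Unary.All.Properties as All
open import Data.List.Relation.Unary.AllPairs using ([]; _∷_)
open import Data.List.Relation.Unary.Any using (here; there; index)
open import Data.List.Relation.Unary.Any.Properties using (lookup-index)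
open import Data.List.Relation.Unary.Unique.Propositional.Properties using (++⁺)
open import Data.Maybe using (Maybe; nothing; is-just; to-witness-T)
open import Data.Maybe.Properties using (just-injective)
open import Data.Nat using (zero; pred; _^_; _<_; z≤n; s≤s; _≡ᵇ_)
import Data.Nat as ℕ
open import Data.Nat.ListAction using (sum)
open import Data.Nat.Properties
open import Data.Nat.Tactic.RingSolver using (solve-∀)
open import Data.Product using (proj₁; proj₂)
open import Data.Product.Properties using (≡-dec)
open import Data.Sum using (_⊎_; inj₁; inj₂)
import Data.Sum.Properties as Sum
open import Data.Unit using (tt)
open import Function using (_∘_; _$_; id; _⇔_; mk⇔; Equivalence)
open import Relation.Binary.Construct.Closure.ReflexiveTransitive using (Star; ε; _◅_; _◅◅_; gmap)
open import Relation.Binary.Construct.Closure.Transitive as TC using (TransClosure)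
open import Relation.Binary.PropositionalEquality
  using (_≢_; refl; sym; trans; cong; cong₂; subst; subst₂; module ≡-Reasoning)
open import Relation.Nullary using (¬_; Dec; yes; no; contradiction)
open import Relation.Nullary.Decidable using (_→-dec_; _×-dec_; ¬?; dec-true; dec-false)

-- Positions, duplicates and counting in lists.

private
  variable
    X : Set

infix 4 _⊑_

-- Pointers are positions, so this is the extension order of node lists and of queues: whatever a
-- pointer reaches in `xs` it still reaches in `ys`.
_⊑_ : List X → List X → Set
xs ⊑ ys = ∀ i {x} → xs at i ≡ just x → ys at i ≡ just x

at-++ : ∀ (xs : List X) {ys} → xs ⊑ xs ++ ys
at-++ []       zero    ()
at-++ []       (suc _) ()
at-++ (x ∷ xs) zero    eq = eq
at-++ (x ∷ xs) (suc i) eq = at-++ xs i eq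

at-length : ∀ (xs : List X) {x} → (xs ∷ʳ x) at length xs ≡ just x
at-length []       = refl
at-length (_ ∷ xs) = at-length xs

at-< : ∀ (xs : List X) i {x} → xs at i ≡ just x → i < length xs
at-< []       zero    ()
at-< []       (suc i) ()
at-< (_ ∷ xs) zero    _  = s≤s z≤n
at-< (_ ∷ xs) (suc i) eq = s≤s (at-< xs i eq)

at-lookup : ∀ (xs : List X) j → xs at toℕ j ≡ just (lookup xs j)
at-lookup (x ∷ xs) Fin.zero    = refl
at-lookup (x ∷ xs) (Fin.suc j) = at-lookup xs j

at-index : ∀ {xs : List X} {x} (x∈xs : x ∈ xs) → xs at toℕ (index x∈xs) ≡ just x
at-index {xs = xs} x∈xs = trans (at-lookup xs (index x∈xs)) (cong just (sym (lookup-index x∈xs)))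

at⇒∈ : ∀ (xs : List X) i {x} → xs at i ≡ just x → x ∈ xs
at⇒∈ []       zero    ()
at⇒∈ []       (suc i) ()
at⇒∈ (_ ∷ xs) zero    eq = here (sym (just-injective eq))
at⇒∈ (_ ∷ xs) (suc i) eq = there (at⇒∈ xs i eq)

at-injective : ∀ {xs : List X} {x} i j → Unique xs → xs at i ≡ just x → xs at j ≡ just x → i ≡ j
at-injective {xs = []}     zero    _       _          ()
at-injective {xs = []}     (suc _) _       _          ()
at-injective {xs = _ ∷ _}  zero    zero    _          _    _    = refl
at-injective {xs = _ ∷ xs} zero    (suc j) (x∉ ∷ _)   refl e    = contradiction refl (All.lookup x∉ (at⇒∈ xs j e))
at-injective {xs = _ ∷ xs} (suc i) zero    (x∉ ∷ _)   e    refl = contradiction refl (All.lookup x∉ (at⇒∈ xs i e))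
at-injective {xs = _ ∷ _}  (suc i) (suc j) (_ ∷ u)    e    f    = cong suc (at-injective i j u e f)

⊑⇒∈ : ∀ {xs ys : List X} {x} → xs ⊑ ys → x ∈ xs → x ∈ ys
⊑⇒∈ {ys = ys} xs⊑ys x∈xs = at⇒∈ ys (toℕ (index x∈xs)) (xs⊑ys (toℕ (index x∈xs)) (at-index x∈xs))

at-∷ʳ : ∀ (xs : List X) k {x y} → (xs ∷ʳ x) at k ≡ just y →
        xs at k ≡ just y ⊎ (k ≡ length xs × y ≡ x)
at-∷ʳ []       zero          refl = inj₂ (refl , refl)
at-∷ʳ []       (suc zero)    ()
at-∷ʳ []       (suc (suc _)) ()
at-∷ʳ (_ ∷ xs) zero          e    = inj₁ e
at-∷ʳ (_ ∷ xs) (suc k)       e with at-∷ʳ xs k e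
... | inj₁ e′           = inj₁ e′
... | inj₂ (refl , y≡x) = inj₂ (refl , y≡x)

drop-tabulate : ∀ {n} (f : Fin n → X) j → drop (toℕ j) (tabulate f) ≡ f j ∷ drop (suc (toℕ j)) (tabulate f)
drop-tabulate f Fin.zero    = refl
drop-tabulate f (Fin.suc j) = drop-tabulate (f ∘ Fin.suc) j

unique-∷ʳ : ∀ {xs : List X} {x} → Unique xs → x ∉ xs → Unique (xs ∷ʳ x)
unique-∷ʳ u x∉xs = ++⁺ u ([] ∷ []) λ { (y∈xs , here refl) → x∉xs y∈xs }

length-∷ʳ : ∀ (xs : List X) {x} → length (xs ∷ʳ x) ≡ suc (length xs)
length-∷ʳ xs = trans (length-++ xs) (+-comm (length xs) 1)

count : (X → Bool) → List X → ℕ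
count f xs = length (filterᵇ f xs)

count-mono : ∀ {f g : X → Bool} xs → (∀ x → T (f x) → T (g x)) → count f xs ≤ count g xs
count-mono []       f⇒g = z≤n
count-mono {f = f} {g} (x ∷ xs) f⇒g with f x | g x | f⇒g x
... | true  | true  | _ = s≤s (count-mono xs f⇒g)
... | true  | false | h = ⊥-elim (h tt)
... | false | true  | _ = m≤n⇒m≤1+n (count-mono xs f⇒g)
... | false | false | _ = count-mono xs f⇒g

count-strict : ∀ {f g : X → Bool} {x xs} → (∀ y → T (f y) → T (g y)) →
               x ∈ xs → f x ≡ false → T (g x) → count f xs < count g xs
count-strict {f = f} {g} {x} f⇒g (here {xs = xs} refl) fx gx with f x | g x
... | false | true = s≤s (count-mono xs f⇒g)
count-strict {f = f} {g} f⇒g (there {x = y} x∈xs) fx gx with f y | g y | f⇒g y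
... | true  | true  | _ = s≤s (count-strict f⇒g x∈xs fx gx)
... | true  | false | h = ⊥-elim (h tt)
... | false | true  | _ = m≤n⇒m≤1+n (count-strict f⇒g x∈xs fx gx)
... | false | false | _ = count-strict f⇒g x∈xs fx gx

-- Derivations

module _ {σ} {𝒢 : CFG σ} where

  infixr 5 _⊗_

  _⊗_ : ∀ {α α′ β β′} → Star (Rewrites 𝒢) α α′ → Star (Rewrites 𝒢) β β′ →
        Star (Rewrites 𝒢) (α ++ β) (α′ ++ β′)
  _⊗_ {α} {α′} {β} {β′} d e = gmap (_++ β) before d ◅◅ gmap (α′ ++_) after e
    where
    before : ∀ {γ δ} → Rewrites 𝒢 γ δ → Rewrites 𝒢 (γ ++ β) (δ ++ β)
    before (rewrite-at {A} {γ} η ζ A→γ) =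
      subst₂ (Rewrites 𝒢) (sym (++-assoc η _ β))
        (sym (trans (++-assoc η _ β) (cong (η ++_) (++-assoc γ ζ β))))
        (rewrite-at η (ζ ++ β) A→γ)
    after : ∀ {γ δ} → Rewrites 𝒢 γ δ → Rewrites 𝒢 (α′ ++ γ) (α′ ++ δ)
    after (rewrite-at η ζ A→γ) =
      subst₂ (Rewrites 𝒢) (++-assoc α′ η _) (++-assoc α′ η _) (rewrite-at (α′ ++ η) ζ A→γ)

  apply : ∀ {A γ w} → (A , γ) ∈ P 𝒢 → Star (Rewrites 𝒢) γ (map inj₂ w) → 𝓛 𝒢 A w
  apply {γ = γ} A→γ d =
    subst (Rewrites 𝒢 _) (++-identityʳ γ) (rewrite-at [] [] A→γ) ◅ d

  _⊗ʷ_ : ∀ {α β w z} → Star (Rewrites 𝒢) α (map inj₂ w) → Star (Rewrites 𝒢) β (map inj₂ z) →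
         Star (Rewrites 𝒢) (α ++ β) (map inj₂ (w ++ z))
  _⊗ʷ_ {w = w} {z} d e = subst (Star (Rewrites 𝒢) _) (sym (map-++ inj₂ w z)) (d ⊗ e)

-- DAGs and witnesses

-- Tree G D p u v π w n : the DAG D unfolds at p to a tree of n nodes that
-- denotes the path π from u to v with trace w.
data Tree {σ} (G : Graph σ) (D : Dag (#V G)) :
          ℕ → V G → V G → List (V G × V G) → List (Fin σ) → ℕ → Set where
  edge   : ∀ {p u v a} → D at p ≡ just (edge u v) → arc G u v ≡ just a →
           Tree G D p u v [ (u , v) ] [ a ] 1
  eps    : ∀ {p u} → D at p ≡ just (eps u) → Tree G D p u u [] [] 1
  concat : ∀ {p q s u x v π ρ w z m n} → D at p ≡ just (concat q s) →
           Tree G D q u x π w m → Tree G D s x v ρ z n →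
           Tree G D p u v (π ++ ρ) (w ++ z) (suc (m + n))

record TreeAt {σ} (G : Graph σ) (D : Dag (#V G)) (p : ℕ) : Set where
  constructor ⟨_⟩
  field
    {source target} : V G
    {edges}         : List (V G × V G)
    {word}          : List (Fin σ)
    {size}          : ℕ
    root-tree       : Tree G D p source target edges word size

open TreeAt using (word; size; root-tree)

module _ {σ} {G : Graph σ} {D : Dag (#V G)} where

  infixr 5 _++ₚ_

  _++ₚ_ : ∀ {u x v π ρ w z} → Path G u x π w → Path G x v ρ z → Path G u v (π ++ ρ) (w ++ z)
  []        ++ₚ d = d
  step a c  ++ₚ d = step a (c ++ₚ d)

  path : ∀ {p u v π w n} → Tree G D p u v π w n → Path G u v π w
  path (edge _ a)     = step a []
  path (eps _)        = []
  path (concat _ l r) = path l ++ₚ path r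

  denotes : ∀ {p u v π w n} → Tree G D p u v π w n → Denotes D p π
  denotes (edge e _)     = edge e
  denotes (eps e)        = eps e
  denotes (concat e l r) = concat e (denotes l) (denotes r)

  size>0 : ∀ {p u v π w n} → Tree G D p u v π w n → 1 ≤ n
  size>0 (edge _ _)     = s≤s z≤n
  size>0 (eps _)        = s≤s z≤n
  size>0 (concat _ _ _) = s≤s z≤n

  -- A pointer fixes the kind of its node, its children and, through `arc`, its label. Word and size
  -- are therefore attributes of the pointer, along whichever route of the shared DAG a tree was
  -- obtained.
  tree-unique : ∀ {p u v π w n u′ v′ π′ w′ n′} →
    Tree G D p u v π w n → Tree G D p u′ v′ π′ w′ n′ → w ≡ w′ × n ≡ n′
  tree-unique (edge e a) (edge e′ a′) with refl ← trans (sym e) e′ with refl ← trans (sym a) a′ = refl , refl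
  tree-unique (edge e _) (eps e′) with () ← trans (sym e) e′
  tree-unique (edge e _) (concat e′ _ _) with () ← trans (sym e) e′
  tree-unique (eps e) (edge e′ _) with () ← trans (sym e) e′
  tree-unique (eps e) (eps e′) = refl , refl
  tree-unique (eps e) (concat e′ _ _) with () ← trans (sym e) e′
  tree-unique (concat e _ _) (edge e′ _) with () ← trans (sym e) e′
  tree-unique (concat e _ _) (eps e′) with () ← trans (sym e) e′
  tree-unique (concat e l r) (concat e′ l′ r′) with refl ← trans (sym e) e′
    with refl , refl ← tree-unique l l′ | refl , refl ← tree-unique r r′ = refl , refl

  node : ∀ {p} → TreeAt G D p → ∃[ x ] D at p ≡ just x
  node ⟨ edge e _ ⟩     = _ , e
  node ⟨ eps e ⟩        = _ , e
  node ⟨ concat e _ _ ⟩ = _ , e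

  child-tree : ∀ {p q} → Child D p q → (t : TreeAt G D p) →
               Σ[ t′ ∈ TreeAt G D q ] size t′ < size t
  child-tree (left e)  ⟨ edge e′ _ ⟩ with () ← trans (sym e) e′
  child-tree (left e)  ⟨ eps e′ ⟩    with () ← trans (sym e) e′
  child-tree (left e)  ⟨ concat e′ l r ⟩ with refl ← trans (sym e) e′ = ⟨ l ⟩ , s≤s (m≤m+n _ _)
  child-tree (right e) ⟨ edge e′ _ ⟩ with () ← trans (sym e) e′
  child-tree (right e) ⟨ eps e′ ⟩    with () ← trans (sym e) e′
  child-tree (right e) ⟨ concat e′ l r ⟩ with refl ← trans (sym e) e′ = ⟨ r ⟩ , s≤s (m≤n+m _ _)

-- Witness 𝒢 G D κ A u v p π w ℓ n : a Tree … p u v π w n assembled from the records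
-- of the entry (A , u , v) of rank ℓ and of the entries below it.  The rank of an
-- entry is the number of nonterminals inserted at (u , v) before it.
data Witness {σ} (𝒢 : CFG σ) (G : Graph σ) (D : Dag (#V G)) :
     Kind → N 𝒢 → V G → V G → ℕ → List (V G × V G) → List (Fin σ) → ℕ → ℕ → Set where
  term : ∀ {κ A a u v p ℓ} → (A , inj₂ a ∷ []) ∈ P 𝒢 → arc G u v ≡ just a →
         D at p ≡ just (edge u v) → Witness 𝒢 G D κ A u v p [ (u , v) ] [ a ] ℓ 1
  eps  : ∀ {κ u p ℓ} → (start 𝒢 , []) ∈ P 𝒢 →
         D at p ≡ just (eps u) → Witness 𝒢 G D κ (start 𝒢) u u p [] [] ℓ 1
  bin  : ∀ {A B C u x v p q s π ρ w z ℓ ℓ₁ ℓ₂ m n} → (A , inj₁ B ∷ inj₁ C ∷ []) ∈ P 𝒢 →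
         D at p ≡ just (concat q s) →
         ℓ₁ < #N 𝒢 → (x ≡ v → ℓ₁ < ℓ) → Witness 𝒢 G D sat B u x q π w ℓ₁ m →
         ℓ₂ < #N 𝒢 → (u ≡ x → ℓ₂ < ℓ) → Witness 𝒢 G D sat C x v s ρ z ℓ₂ n →
         Witness 𝒢 G D sat A u v p (π ++ ρ) (w ++ z) ℓ (suc (m + n))
  linL : ∀ {A a B u x v p q s ρ z ℓ ℓ₁ n} → (A , inj₂ a ∷ inj₁ B ∷ []) ∈ P 𝒢 →
         D at p ≡ just (concat q s) →
         D at q ≡ just (edge u x) → arc G u x ≡ just a →
         Witness 𝒢 G D lin B x v s ρ z ℓ₁ n →
         Witness 𝒢 G D lin A u v p ((u , x) ∷ ρ) (a ∷ z) ℓ (suc (suc n))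
  linR : ∀ {A a B u x v p q s π w ℓ ℓ₁ m} → (A , inj₁ B ∷ inj₂ a ∷ []) ∈ P 𝒢 →
         D at p ≡ just (concat q s) →
         Witness 𝒢 G D lin B u x q π w ℓ₁ m →
         D at s ≡ just (edge x v) → arc G x v ≡ just a →
         Witness 𝒢 G D lin A u v p (π ++ [ (x , v) ]) (w ++ [ a ]) ℓ (suc (m + 1))

module _ {σ} {𝒢 : CFG σ} {G : Graph σ} where

  weaken : ∀ {D D′ κ A u v p π w ℓ n} → D ⊑ D′ →
           Witness 𝒢 G D κ A u v p π w ℓ n → Witness 𝒢 G D′ κ A u v p π w ℓ n
  weaken D⊑D′ (term {p = p} r a e)                      = term r a (D⊑D′ p e)
  weaken D⊑D′ (eps {p = p} r e)                         = eps r (D⊑D′ p e)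
  weaken D⊑D′ (bin {p = p} r e b₁ d₁ t₁ b₂ d₂ t₂)       =
    bin r (D⊑D′ p e) b₁ d₁ (weaken D⊑D′ t₁) b₂ d₂ (weaken D⊑D′ t₂)
  weaken D⊑D′ (linL {p = p} {q = q} r e f a t)          = linL r (D⊑D′ p e) (D⊑D′ q f) a (weaken D⊑D′ t)
  weaken D⊑D′ (linR {p = p} {s = s} r e t f a)          = linR r (D⊑D′ p e) (weaken D⊑D′ t) (D⊑D′ s f) a

  module _ {D : Dag (#V G)} where

    tree : ∀ {κ A u v p π w ℓ n} → Witness 𝒢 G D κ A u v p π w ℓ n → Tree G D p u v π w n
    tree (term _ a e)           = edge e a
    tree (eps _ e)              = eps e
    tree (bin _ e _ _ l _ _ r)  = concat e (tree l) (tree r)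
    tree (linL _ e f a t)       = concat e (edge f a) (tree t)
    tree (linR _ e t f a)       = concat e (tree t) (edge f a)

    generated : ∀ {κ A u v p π w ℓ n} → Witness 𝒢 G D κ A u v p π w ℓ n → 𝓛 𝒢 A w
    generated (term r _ _)             = apply r ε
    generated (eps r _)                = apply r ε
    generated (bin r _ _ _ d _ _ e)    = apply r (_⊗ʷ_ {α = [ _ ]} (generated d) (generated e))
    generated (linL {a = a} r _ _ _ d) = apply r (_⊗_ {α = [ inj₂ a ]} ε (generated d))
    generated (linR {a = a} r _ d _ _) = apply r (_⊗ʷ_ {α = [ _ ]} {β = [ inj₂ a ]} {z = [ a ]} (generated d) ε)

    -- Tree sizes under linear rules or isolated ε.

    lin-size : ∀ {A u v p π w ℓ n} → Witness 𝒢 G D lin A u v p π w ℓ n → n ≤ suc (2 * length π)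
    lin-size (term _ _ _) = s≤s z≤n
    lin-size (eps _ _)    = s≤s z≤n
    lin-size (linL {ρ = ρ} {n = n} _ _ _ _ t) = begin
      -- A linear record adds a `concat` node and an edge leaf, against one more edge of the path.
      2 + n                       ≤⟨ +-monoʳ-≤ 2 (lin-size t) ⟩
      2 + suc (2 * length ρ)      ≡⟨ lemma (length ρ) ⟩
      suc (2 * suc (length ρ))    ∎
      where
      open ≤-Reasoning
      lemma : ∀ k → 2 + suc (2 * k) ≡ suc (2 * suc k)
      lemma = solve-∀
    lin-size (linR {π = π} {m = m} _ _ t _ _) = begin
      suc (m + 1)                      ≤⟨ s≤s (+-monoˡ-≤ 1 (lin-size t)) ⟩
      suc (suc (2 * length π) + 1)     ≡⟨ lemma (length π) ⟩
      suc (2 * (length π + 1))         ≡⟨ cong (λ k → suc (2 * k)) (length-++ π) ⟨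
      suc (2 * length (π ++ [ _ ]))    ∎
      where
      open ≤-Reasoning
      lemma : ∀ k → suc (suc (2 * k) + 1) ≡ suc (2 * (k + 1))
      lemma = solve-∀

    -- The first alternative is the lone Eps leaf. Isolation excludes it for both children of a
    -- binary rule, so all leaves of any other tree are edges, and k leaves make 2k - 1 nodes.
    isolated-size : ∀ {A u v p π w ℓ n} → ε-Isolated 𝒢 → Witness 𝒢 G D sat A u v p π w ℓ n →
      (A ≡ start 𝒢 × (start 𝒢 , []) ∈ P 𝒢 × n ≤ 1) ⊎ suc n ≤ 2 * length π
    isolated-size iso (term _ _ _) = inj₂ ≤-refl
    isolated-size iso (eps r _)    = inj₁ (refl , r , ≤-refl)
    isolated-size iso (bin {π = π} {ρ} {m = m} {n} r _ _ _ t₁ _ _ t₂)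
      with isolated-size iso t₁ | isolated-size iso t₂
    ... | inj₁ (B≡S , h , _) | _ = contradiction B≡S (proj₁ (iso h _ _ _ r))
    ... | inj₂ _ | inj₁ (C≡S , h , _) = contradiction C≡S (proj₂ (iso h _ _ _ r))
    ... | inj₂ le₁ | inj₂ le₂ = inj₂ (begin
      suc (suc (m + n))              ≡⟨ cong suc (+-suc m n) ⟨
      suc m + suc n                  ≤⟨ +-mono-≤ le₁ le₂ ⟩
      2 * length π + 2 * length ρ    ≡⟨ *-distribˡ-+ 2 (length π) _ ⟨
      2 * (length π + length ρ)      ≡⟨ cong (2 *_) (length-++ π) ⟨
      2 * length (π ++ ρ)            ∎)
      where open ≤-Reasoning

    -- An empty sibling thus supplies the equality of endpoints under which `bin` lowers the rank.
    loop : ∀ {κ A u v p w ℓ n} → Witness 𝒢 G D κ A u v p [] w ℓ n → u ≡ v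
    loop t with [] ← path (tree t) = refl

-- Tree sizes in the general case.

sizeFactor : ℕ → ℕ
sizeFactor N = 2 * (N * 2 ^ suc N)

module _ {σ} {𝒢 : CFG σ} {G : Graph σ} {D : Dag (#V G)} where

  private
    -- `K` exceeds the size of a subtree with empty path and rank below `#N 𝒢`; `C` pays for `#N 𝒢`
    -- of them attached in a row; `sizeFactor` is `2 * C`.
    K C : ℕ
    K = 2 ^ suc (#N 𝒢)
    C = #N 𝒢 * K

    K≥1 : 1 ≤ K
    K≥1 = m^n>0 2 (suc (#N 𝒢))

  -- Both children of a `bin` node with empty path are loops at the same vertex, so their ranks are
  -- below `ℓ`: the tree is binary of depth at most `ℓ`. Emptiness is an equation on the length
  -- because `π ++ ρ` does not unify with `[]`.
  empty-size : ∀ {κ A u v p π w ℓ n} → Witness 𝒢 G D κ A u v p π w ℓ n → length π ≡ 0 → n < 2 ^ suc ℓ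
  empty-size (eps {ℓ = ℓ} _ _) _ = *-monoʳ-≤ 2 (m^n>0 2 ℓ)
  empty-size (bin {π = []} {[]} {ℓ = ℓ} {ℓ₁} {ℓ₂} {m} {n} _ _ _ d₁ t₁ _ d₂ t₂) refl = begin
    suc (suc (m + n))                  ≡⟨ cong suc (+-suc m n) ⟨
    suc m + suc n                      ≤⟨ +-mono-≤ (empty-size t₁ refl) (empty-size t₂ refl) ⟩
    2 ^ suc ℓ₁ + 2 ^ suc ℓ₂            ≤⟨ +-mono-≤ (^-monoʳ-≤ 2 (d₁ (loop t₂))) (^-monoʳ-≤ 2 (d₂ (loop t₁))) ⟩
    2 ^ ℓ + 2 ^ ℓ                      ≡⟨ cong (2 ^ ℓ +_) (+-identityʳ (2 ^ ℓ)) ⟨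
    2 ^ suc ℓ                          ∎
    where open ≤-Reasoning
  empty-size (linR {π = []} _ _ _ _ _) ()
  empty-size (linR {π = _ ∷ _} _ _ _ _ _) ()

  empty-size-K : ∀ {κ A u v p w ℓ n} → ℓ < #N 𝒢 → Witness 𝒢 G D κ A u v p [] w ℓ n → n < K
  empty-size-K ℓ<N t = <-≤-trans (empty-size t refl) (^-monoʳ-≤ 2 (m≤n⇒m≤1+n ℓ<N))

  -- A potential argument: `2 * C` for every edge after the first and `K` for every unit of rank. If
  -- one child is empty, the other keeps the endpoints and loses rank, and the `K` set free pays for
  -- the empty child and the root. If neither is empty, the additional edge pays for two ranks
  -- starting afresh.
  nonempty-size : ∀ {A u v p π w ℓ n k} → ℓ < #N 𝒢 → Witness 𝒢 G D sat A u v p π w ℓ n →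
                  length π ≡ suc k → n ≤ k * (2 * C) + suc ℓ * K
  nonempty-size {ℓ = ℓ} {k = k} _ (term _ _ _) refl =
    ≤-trans K≥1 (≤-trans (m≤m+n K (ℓ * K)) (m≤n+m _ (k * (2 * C))))
  nonempty-size _ (bin {π = []} {[]} _ _ _ _ _ _ _ _) ()
  nonempty-size {ℓ = ℓ} {k = k} _
    (bin {π = []} {_ ∷ _} {ℓ₂ = ℓ₂} {m} {n} _ _ b₁ d₁ t₁ b₂ d₂ t₂) eq = begin
    suc m + n                              ≤⟨ +-mono-≤ (empty-size-K b₁ t₁) (nonempty-size b₂ t₂ eq) ⟩
    K + (k * (2 * C) + suc ℓ₂ * K)         ≤⟨ +-monoʳ-≤ K (+-monoʳ-≤ (k * (2 * C)) (*-monoˡ-≤ K (d₂ (loop t₁)))) ⟩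
    K + (k * (2 * C) + ℓ * K)              ≡⟨ lemma K (k * (2 * C)) (ℓ * K) ⟩
    k * (2 * C) + suc ℓ * K                ∎
    where
    open ≤-Reasoning
    lemma : ∀ a b c → a + (b + c) ≡ b + (a + c)
    lemma = solve-∀
  nonempty-size {ℓ = ℓ} {k = k} _
    (bin {π = e ∷ π} {[]} {ℓ₁ = ℓ₁} {m = m} {n} _ _ b₁ d₁ t₁ b₂ d₂ t₂) eq = begin
    suc (m + n)                            ≡⟨ +-suc m n ⟨
    m + suc n                              ≤⟨ +-mono-≤ (nonempty-size b₁ t₁ eq′) (empty-size-K b₂ t₂) ⟩
    k * (2 * C) + suc ℓ₁ * K + K           ≤⟨ +-monoˡ-≤ K (+-monoʳ-≤ (k * (2 * C)) (*-monoˡ-≤ K (d₁ (loop t₂)))) ⟩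
    k * (2 * C) + ℓ * K + K                ≡⟨ lemma (k * (2 * C)) (ℓ * K) K ⟩
    k * (2 * C) + suc ℓ * K                ∎
    where
    open ≤-Reasoning
    eq′ : length (e ∷ π) ≡ suc k
    eq′ = trans (sym (cong length (++-identityʳ (e ∷ π)))) eq
    lemma : ∀ a b c → a + b + c ≡ a + (c + b)
    lemma = solve-∀
  nonempty-size {ℓ = ℓ} _
    (bin {π = _ ∷ π} {_ ∷ ρ} {ℓ₁ = ℓ₁} {ℓ₂} {m} {n} _ _ b₁ d₁ t₁ b₂ d₂ t₂) refl = begin
    suc (m + n)
      ≤⟨ s≤s (+-mono-≤ (nonempty-size b₁ t₁ refl) (nonempty-size b₂ t₂ refl)) ⟩
    suc (a * (2 * C) + suc ℓ₁ * K + (b * (2 * C) + suc ℓ₂ * K))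
      -- At a proper branching the ranks need not decrease; only `ℓ₁ , ℓ₂ < #N 𝒢` is used, which
      -- bounds each rank term by `C`.
      ≤⟨ s≤s (+-mono-≤ (+-monoʳ-≤ (a * (2 * C)) (*-monoˡ-≤ K b₁)) (+-monoʳ-≤ (b * (2 * C)) (*-monoˡ-≤ K b₂))) ⟩
    suc (a * (2 * C) + C + (b * (2 * C) + C))
      ≡⟨ lemma a b C ⟩
    (a + suc b) * (2 * C) + 1
      -- The root node, the remaining 1, is paid from the rank term.
      ≤⟨ +-monoʳ-≤ ((a + suc b) * (2 * C)) (≤-trans K≥1 (m≤m+n K (ℓ * K))) ⟩
    (a + suc b) * (2 * C) + suc ℓ * K
      ≡⟨ cong (λ k → k * (2 * C) + suc ℓ * K) (length-++ π) ⟨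
    length (π ++ _ ∷ ρ) * (2 * C) + suc ℓ * K ∎
    where
    open ≤-Reasoning
    a = length π
    b = length ρ
    lemma : ∀ a b c → suc (a * (2 * c) + c + (b * (2 * c) + c)) ≡ (a + suc b) * (2 * c) + 1
    lemma = solve-∀

  sat-size : ∀ {A u v p π w ℓ n} → ℓ < #N 𝒢 → Witness 𝒢 G D sat A u v p π w ℓ n →
             n ≤ sizeFactor (#N 𝒢) * suc (length π)
  sat-size {π = []} {ℓ = ℓ} {n} ℓ<N t = begin
    n             ≤⟨ <⇒≤ (empty-size-K ℓ<N t) ⟩
    K             ≡⟨ *-identityˡ K ⟨
    -- A rank below `#N 𝒢` shows that `#N 𝒢` is positive.
    1 * K         ≤⟨ *-monoˡ-≤ K (≤-trans (s≤s z≤n) ℓ<N) ⟩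
    C             ≤⟨ m≤m+n C _ ⟩
    2 * C         ≡⟨ *-identityʳ (2 * C) ⟨
    2 * C * 1     ∎
    where open ≤-Reasoning
  sat-size {π = _ ∷ π} {ℓ = ℓ} {n} ℓ<N t = begin
    n                                  ≤⟨ nonempty-size ℓ<N t refl ⟩
    k * (2 * C) + suc ℓ * K            ≤⟨ +-monoʳ-≤ (k * (2 * C)) (*-monoˡ-≤ K ℓ<N) ⟩
    k * (2 * C) + C                    ≤⟨ m≤m+n _ (3 * C) ⟩
    k * (2 * C) + C + 3 * C            ≡⟨ lemma k C ⟩
    2 * C * suc (suc k)                ∎
    where
    open ≤-Reasoning
    k = length π
    lemma : ∀ k c → k * (2 * c) + c + 3 * c ≡ 2 * c * suc (suc k)
    lemma = solve-∀

-- Hash-consing along a history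

module _ {n} (D : Dag n) (x : Node n) where

  cons-⊑ : D ⊑ proj₁ (cons D x)
  cons-⊑ i e with DecMembership._∈?_ _≟ₙ_ x D
  ... | yes _ = e
  ... | no _  = at-++ D i e

  cons-at : proj₁ (cons D x) at proj₂ (cons D x) ≡ just x
  cons-at with DecMembership._∈?_ _≟ₙ_ x D
  ... | yes x∈D = at-index x∈D
  ... | no _    = at-length D

  cons-unique : Unique D → Unique (proj₁ (cons D x))
  cons-unique u with DecMembership._∈?_ _≟ₙ_ x D
  ... | yes _  = u
  ... | no x∉D = unique-∷ʳ u x∉D

  cons-length : length (proj₁ (cons D x)) ≤ suc (length D)
  cons-length with DecMembership._∈?_ _≟ₙ_ x D
  ... | yes _ = n≤1+n _
  ... | no _  = ≤-reflexive (length-∷ʳ D)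

-- Recovers the value of `root` from a `pointer`, which is extracted with a proof of presence.
to-witness-just : ∀ (m : Maybe X) t → m ≡ just (to-witness-T m t)
to-witness-just (just _) _ = refl

module _ {σ} {𝒢 : CFG σ} {G : Graph σ} where

  writes : ∀ {X} (e : Entry 𝒢 G) (x : X) f e′ →
           (e ≡ e′ × write {𝒢 = 𝒢} {G} e x f e′ ≡ just x) ⊎ write {𝒢 = 𝒢} {G} e x f e′ ≡ f e′
  writes e x f e′ with _≟ₑ_ {𝒢 = 𝒢} {G} e e′
  ... | yes e≡e′ = inj₁ (e≡e′ , refl)
  ... | no _     = inj₂ refl

  write-same : ∀ {X} (e : Entry 𝒢 G) (x : X) f → write {𝒢 = 𝒢} {G} e x f e ≡ just x
  write-same e x f with _≟ₑ_ {𝒢 = 𝒢} {G} e e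
  ... | yes _  = refl
  ... | no e≢e = contradiction refl e≢e

  ∈-entries : ∀ e → e ∈ entries 𝒢 G
  ∈-entries (A , u , v) =
    ∈-cartesianProduct⁺ (∈-allFin A) (∈-cartesianProduct⁺ (∈-allFin u) (∈-allFin v))

  module _ {κ : Kind} where

    #inserted : Table 𝒢 G κ → ℕ
    #inserted W = count (λ e → is-just (W e)) (entries 𝒢 G)

    rank : Table 𝒢 G κ → V G → V G → ℕ
    rank W u v = count (λ A → is-just (W (A , u , v))) (allFin (#N 𝒢))

    rank≤N : ∀ W u v → rank W u v ≤ #N 𝒢
    rank≤N W u v = ≤-trans (length-filter _ (allFin (#N 𝒢))) (≤-reflexive (length-tabulate id))

    module _ (W : Table 𝒢 G κ) (e : Entry 𝒢 G) (ω : Record 𝒢 G κ) (fresh : W e ≡ nothing) where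

      private
        W⁺ : Table 𝒢 G κ
        W⁺ = write {𝒢 = 𝒢} {G} e ω W

      write-keeps : ∀ e′ → T (is-just (W e′)) → T (is-just (W⁺ e′))
      write-keeps e′ t with writes e ω W e′
      ... | inj₁ (_ , eq) = subst (T ∘ is-just) (sym eq) tt
      ... | inj₂ eq       = subst (T ∘ is-just) (sym eq) t

      private
        absent : is-just (W e) ≡ false
        absent = cong is-just fresh

        present : T (is-just (W⁺ e))
        present = subst (T ∘ is-just) (sym (write-same e ω W)) tt

      #inserted-grows : #inserted W < #inserted W⁺
      #inserted-grows = count-strict write-keeps (∈-entries e) absent present

      rank-mono : ∀ u v → rank W u v ≤ rank W⁺ u v
      rank-mono u v = count-mono (allFin (#N 𝒢)) λ A → write-keeps (A , u , v)

      rank-grows : let (_ , u , v) = e in rank W u v < rank W⁺ u v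
      rank-grows = let (A , u , v) = e in
        count-strict (λ A → write-keeps (A , u , v)) (∈-allFin A) absent present

    -- The condition `Q` on the rank is an equation for the entry being compiled and a strict bound
    -- for entries already in the table.
    Witnessed : Dag (#V G) → Entry 𝒢 G → ℕ → (ℕ → Set) → Set
    Witnessed D (A , u , v) p Q =
      ∃[ π ] ∃[ w ] ∃[ ℓ ] ∃[ n ] Witness 𝒢 G D κ A u v p π w ℓ n × Q ℓ

    -- The invariant of the construction. The factor 2 allows for linear records, which need an edge
    -- and a `concat`. A stored rank lies strictly below the present count at its endpoints, which
    -- is the rank the next entry there receives.
    record Sound {W : Table 𝒢 G κ} (S : SWD {𝒢 = 𝒢} {G} W) : Set where
      field
        unique  : Unique (dag S)
        few     : #nodes S ≤ 2 * #inserted W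
        witness : ∀ e {p} → root S e ≡ just p →
                  Witnessed (dag S) e p (_< rank W (proj₁ (proj₂ e)) (proj₂ (proj₂ e)))

    record Compiled (D : Dag (#V G)) (r : Dag (#V G) × ℕ) (e : Entry 𝒢 G) (k : ℕ) : Set where
      field
        extends : D ⊑ proj₁ r
        unique  : Unique (proj₁ r)
        cheap   : length (proj₁ r) ≤ 2 + length D
        witness : Witnessed (proj₁ r) e (proj₂ r) (_≡ k)

  module _ {κ : Kind} {W : Table 𝒢 G κ} {S : SWD {𝒢 = 𝒢} {G} W} (sound : Sound S) where

    open Sound sound

    pointed : ∀ A u v (t : Inserted {𝒢 = 𝒢} {G} W (A , u , v)) →
              Witnessed (dag S) (A , u , v) (pointer S (A , u , v) t) (_< rank W u v)
    pointed A u v t = witness (A , u , v) (to-witness-just (root S (A , u , v)) _)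

  compiled : ∀ {κ} {W : Table 𝒢 G κ} {S : SWD {𝒢 = 𝒢} {G} W} {e ω} → Sound S →
             (j : Justified {𝒢 = 𝒢} {G} W e ω) →
             Compiled {κ} (dag S) (compile S j) e (rank W (proj₁ (proj₂ e)) (proj₂ (proj₂ e)))
  compiled {S = S} sound (term {u = u} {v} r a) = record
    { extends = cons-⊑ D x
    ; unique  = cons-unique D x (Sound.unique sound)
    ; cheap   = m≤n⇒m≤1+n (cons-length D x)
    ; witness = _ , _ , _ , _ , term r a (cons-at D x) , refl
    }
    where D = dag S ; x = edge u v
  compiled {S = S} sound (eps {u = u} r) = record
    { extends = cons-⊑ D x
    ; unique  = cons-unique D x (Sound.unique sound)
    ; cheap   = m≤n⇒m≤1+n (cons-length D x)
    ; witness = _ , _ , _ , _ , eps r (cons-at D x) , refl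
    }
    where D = dag S ; x = eps u
  compiled {W = W} {S} sound (bin {B = B} {C} {u} {x} {v} r s t)
    with _ , _ , _ , _ , d₁ , lt₁ ← pointed sound B u x s
       | _ , _ , _ , _ , d₂ , lt₂ ← pointed sound C x v t = record
    { extends = cons-⊑ D y
    ; unique  = cons-unique D y (Sound.unique sound)
    ; cheap   = m≤n⇒m≤1+n (cons-length D y)
    ; witness = _ , _ , _ , _ ,
        bin r (cons-at D y)
          -- If the sibling closes a loop, the child lies at `(u , v)` itself, and the count
          -- bounding its rank is the rank of the new entry.
          (<-≤-trans lt₁ (rank≤N W u x)) (λ { refl → lt₁ }) (weaken (cons-⊑ D y) d₁)
          (<-≤-trans lt₂ (rank≤N W x v)) (λ { refl → lt₂ }) (weaken (cons-⊑ D y) d₂) ,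
        refl
    }
    where
    D = dag S
    y = concat (pointer S (B , u , x) s) (pointer S (C , x , v) t)
  compiled {W = W} {S} sound (linL {B = B} {u} {x} {v} r c t)
    with _ , _ , _ , _ , d , _ ← pointed sound B x v t = record
    { extends = λ i → cons-⊑ D′ z i ∘ cons-⊑ D y i
    ; unique  = cons-unique D′ z (cons-unique D y (Sound.unique sound))
    ; cheap   = ≤-trans (cons-length D′ z) (s≤s (cons-length D y))
    ; witness = _ , _ , _ , _ ,
        linL r (cons-at D′ z) (cons-⊑ D′ z q (cons-at D y)) c
          (weaken (λ i → cons-⊑ D′ z i ∘ cons-⊑ D y i) d) ,
        refl
    }
    where
    D  = dag S
    y  = edge u x
    D′ = proj₁ (cons D y)
    q  = proj₂ (cons D y)
    z  = concat q (pointer S (B , x , v) t)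
  compiled {W = W} {S} sound (linR {B = B} {u} {x} {v} r t c)
    with _ , _ , _ , _ , d , _ ← pointed sound B u x t = record
    { extends = λ i → cons-⊑ D′ z i ∘ cons-⊑ D y i
    ; unique  = cons-unique D′ z (cons-unique D y (Sound.unique sound))
    ; cheap   = ≤-trans (cons-length D′ z) (s≤s (cons-length D y))
    ; witness = _ , _ , _ , _ ,
        linR r (cons-at D′ z) (weaken (λ i → cons-⊑ D′ z i ∘ cons-⊑ D y i) d)
          (cons-⊑ D′ z q (cons-at D y)) c ,
        refl
    }
    where
    D  = dag S
    y  = edge x v
    D′ = proj₁ (cons D y)
    q  = proj₂ (cons D y)
    z  = concat (pointer S (B , u , x) t) q

  swd-sound : ∀ {κ} {W : Table 𝒢 G κ} (h : History {𝒢 = 𝒢} {G} W) → Sound (swd h)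
  swd-sound empty = record { unique = [] ; few = z≤n ; witness = λ _ () }
  swd-sound (insert {W} {e} {ω} h fresh j) = record
    { unique  = Compiled.unique new
    ; few     = begin
        length (proj₁ (compile (swd h) j))  ≤⟨ Compiled.cheap new ⟩
        2 + #nodes (swd h)                  ≤⟨ +-monoʳ-≤ 2 (Sound.few old) ⟩
        2 + 2 * #inserted W                 ≡⟨ *-suc 2 (#inserted W) ⟨
        2 * suc (#inserted W)               ≤⟨ *-monoʳ-≤ 2 (#inserted-grows W e ω fresh) ⟩
        2 * #inserted (write {𝒢 = 𝒢} {G} e ω W)  ∎
    ; witness = witness′
    }
    where
    open ≤-Reasoning
    old = swd-sound h
    new = compiled old j
    witness′ : ∀ e′ {p} → root (swd (insert h fresh j)) e′ ≡ just p →
      Witnessed (proj₁ (compile (swd h) j)) e′ p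
        (_< rank (write {𝒢 = 𝒢} {G} e ω W) (proj₁ (proj₂ e′)) (proj₂ (proj₂ e′)))
    witness′ e′ eq with writes e (proj₂ (compile (swd h) j)) (root (swd h)) e′
    -- The rank of the new entry is the count before the insertion, and the insertion raises that
    -- count.
    ... | inj₁ (refl , eq′) with refl ← trans (sym eq′) eq =
      let (_ , _ , _ , _ , d , ℓ≡) = Compiled.witness new
      in _ , _ , _ , _ , d , ≤-<-trans (≤-reflexive ℓ≡) (rank-grows W e ω fresh)
    ... | inj₂ eq′ =
      let (_ , _ , _ , _ , d , lt) = Sound.witness old e′ (trans (sym eq′) eq)
      in _ , _ , _ , _ , weaken (Compiled.extends new) d , <-≤-trans lt (rank-mono W e ω fresh _ _)

  #roots≤#true : ∀ {κ} (ix : Index κ 𝒢 G) → #roots (SWDIndex ix) ≤ #true ix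
  #roots≤#true ix = count-mono (entries 𝒢 G) λ e → subst T (sym (rooted (SWDIndex ix) e))

words-length : ∀ {n} (D : Dag n) → sum (map (length ∘ words) D) ≤ 3 * length D
words-length []      = z≤n
words-length (x ∷ D) = begin
  length (words x) + sum (map (length ∘ words) D)  ≤⟨ +-mono-≤ (node-words x) (words-length D) ⟩
  3 + 3 * length D                                 ≡⟨ *-suc 3 (length D) ⟨
  3 * suc (length D)                               ∎
  where
  open ≤-Reasoning
  node-words : ∀ x → length (words x) ≤ 3
  node-words (edge _ _)   = ≤-refl
  node-words (eps _)      = n≤1+n 2
  node-words (concat _ _) = ≤-refl

-- Breadth-first search and the straight-line program

descend : ∀ {σ} {G : Graph σ} {D : Dag (#V G)} {p q} →
          Star (Child D) p q → TreeAt G D p → TreeAt G D q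
descend ε          t = t
descend (c ◅ p⇝q) t = descend p⇝q (proj₁ (child-tree c t))

-- Appending at the end makes positions permanent, so they can serve as the numbers of nonterminals
-- during the search.
add : List ℕ → ℕ → List ℕ
add L q with DecMembership._∈?_ ℕ._≟_ q L
... | yes _ = L
... | no _  = L ∷ʳ q

discover : ∀ {n} → List ℕ → Node n → List ℕ
discover L (edge _ _)   = L
discover L (eps _)      = L
discover L (concat q s) = add (add L q) s

add-⊑ : ∀ L q → L ⊑ add L q
add-⊑ L q i e with DecMembership._∈?_ ℕ._≟_ q L
... | yes _ = e
... | no _  = at-++ L i e

∈-add : ∀ L q → q ∈ add L q
∈-add L q with DecMembership._∈?_ ℕ._≟_ q L
... | yes q∈L = q∈L
... | no _    = ∈-++⁺ʳ L (here refl)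

add-unique : ∀ L q → Unique L → Unique (add L q)
add-unique L q u with DecMembership._∈?_ ℕ._≟_ q L
... | yes _  = u
... | no q∉L = unique-∷ʳ u q∉L

add-All : ∀ {Q : ℕ → Set} L q → All Q L → Q q → All Q (add L q)
add-All L q ps p with DecMembership._∈?_ ℕ._≟_ q L
... | yes _ = ps
... | no _  = All.++⁺ ps (p ∷ [])

discover-⊑ : ∀ {n} L (x : Node n) → L ⊑ discover L x
discover-⊑ L (edge _ _)   i e = e
discover-⊑ L (eps _)      i e = e
discover-⊑ L (concat q s) i e = add-⊑ (add L q) s i (add-⊑ L q i e)

discover-unique : ∀ {n} L (x : Node n) → Unique L → Unique (discover L x)
discover-unique L (edge _ _)   u = u
discover-unique L (eps _)      u = u
discover-unique L (concat q s) u = add-unique (add L q) s (add-unique L q u)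

module _ {n} (D : Dag n) where

  -- BFS i L L′ : the search that has seen L, and has processed the first i
  -- elements of L, ends with L′.
  data BFS : ℕ → List ℕ → List ℕ → Set where
    done  : ∀ {L} → BFS (length L) L L
    visit : ∀ {i L L′ p x} → L at i ≡ just p → D at p ≡ just x →
            BFS (suc i) (discover L x) L′ → BFS i L L′

  discover-All : ∀ {Q : ℕ → Set} L {p} x → D at p ≡ just x → (∀ {q} → Child D p q → Q q) →
                 All Q L → All Q (discover L x)
  discover-All L (edge _ _)   e h ps = ps
  discover-All L (eps _)      e h ps = ps
  discover-All L (concat q s) e h ps = add-All (add L q) s (add-All L q ps (h (left e))) (h (right e))

  child∈discover : ∀ L {p q} x → D at p ≡ just x → Child D p q → q ∈ discover L x
  child∈discover L x e (left {q = q} {s} e′) with refl ← trans (sym e) e′ =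
    ⊑⇒∈ (add-⊑ (add L q) s) (∈-add L q)
  child∈discover L x e (right {q = q} {s} e′) with refl ← trans (sym e) e′ = ∈-add (add L q) s

  bfs-⊑ : ∀ {i L L′} → BFS i L L′ → L ⊑ L′
  bfs-⊑ done k e = e
  bfs-⊑ (visit {L = L} {x = x} _ _ b) k e = bfs-⊑ b k (discover-⊑ L x k e)

  bfs-unique : ∀ {i L L′} → BFS i L L′ → Unique L → Unique L′
  bfs-unique done u = u
  bfs-unique (visit {L = L} {x = x} _ _ b) u = bfs-unique b (discover-unique L x u)

  bfs-All : ∀ {Q : ℕ → Set} → (∀ {p q} → Child D p q → Q p → Q q) →
            ∀ {i L L′} → BFS i L L′ → All Q L → All Q L′
  bfs-All closed done ps = ps
  bfs-All closed (visit {i} {L} {x = x} e f b) ps =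
    bfs-All closed b (discover-All L x f (λ c → closed c (All.lookup ps (at⇒∈ L i e))) ps)

  -- Children enter the list when their parent is processed and never leave it. For `k` equal to `i`
  -- the parent is the node now visited, since positions are stable.
  bfs-closed : ∀ {i L L′} → BFS i L L′ → ∀ k {p q} → i ≤ k → L′ at k ≡ just p → Child D p q → q ∈ L′
  bfs-closed (done {L}) k i≤k e c = contradiction (at-< L k e) (≤⇒≯ i≤k)
  bfs-closed (visit {i} {L} {L′} {x = x} e f b) k i≤k g c with m≤n⇒m<n∨m≡n i≤k
  ... | inj₁ i<k  = bfs-closed b k i<k g c
  ... | inj₂ refl with refl ← trans (sym g) (bfs-⊑ b i (discover-⊑ L x i e)) =
    ⊑⇒∈ (bfs-⊑ b) (child∈discover L x f c)

module _ {n} {D : Dag n} where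

  -- Reachability from `r` passes to children, so every listed node is reachable; conversely the
  -- final list contains `r` and is closed under children.
  bfs-members : ∀ {r L} → BFS D 0 [ r ] L → ∀ q → q ∈ L ⇔ Star (Child D) r q
  bfs-members {r} {L} b q = mk⇔
    (All.lookup (bfs-All D (λ c r⇝p → r⇝p ◅◅ (c ◅ ε)) b (ε ∷ [])))
    (walk (at⇒∈ L 0 (bfs-⊑ D b 0 refl)))
    where
    walk : ∀ {p} → p ∈ L → Star (Child D) p q → q ∈ L
    walk p∈L ε         = p∈L
    walk p∈L (c ◅ p⇝q) = walk (bfs-closed D b (toℕ (index p∈L)) z≤n (at-index p∈L) c) p⇝q

-- Pigeonhole: positions inject into `Fin n` through the listed numbers.
unique-length : ∀ {L n} → Unique L → All (_< n) L → length L ≤ n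
unique-length {L} u L<n = injective⇒≤ {f = λ j → fromℕ< (bound j)} λ {i} {j} eq →
  toℕ-injective (at-injective (toℕ i) (toℕ j) u (at-lookup L i)
    (trans (at-lookup L j) (cong just (sym (fromℕ<-injective _ _ (bound i) (bound j) eq)))))
  where
  bound : ∀ j → lookup L j < _
  bound j = All.lookup L<n (∈-lookup j)

module _ {σ} {G : Graph σ} {D : Dag (#V G)} where

  -- The queue holds distinct pointers into `D`, so it never outgrows `D`; `k` is the fuel for the
  -- visits still possible.
  bfs-exists : ∀ k i L → Unique L → All (TreeAt G D) L → i ≤ length L → length D ≤ i + k →
               ∃[ L′ ] BFS D i L L′
  bfs-exists k i L u ts i≤ D≤ with m≤n⇒m<n∨m≡n i≤
  ... | inj₂ refl = L , done
  bfs-exists zero i L u ts i≤ D≤ | inj₁ i<L = contradiction i<L (≤⇒≯ (begin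
    length L  ≤⟨ unique-length u (All.map (λ {p} t → at-< D p (proj₂ (node t))) ts) ⟩
    length D  ≤⟨ D≤ ⟩
    i + 0     ≡⟨ +-identityʳ i ⟩
    i         ∎))
    where open ≤-Reasoning
  bfs-exists (suc k) i L u ts i≤ D≤ | inj₁ i<L =
    let p       = lookup L (fromℕ< i<L)
        e       = subst (λ k → L at k ≡ just p) (toℕ-fromℕ< i<L) (at-lookup L (fromℕ< i<L))
        t       = All.lookup ts (at⇒∈ L i e)
        (x , f) = node t
        (L′ , b) = bfs-exists k (suc i) (discover L x) (discover-unique L x u)
          (discover-All D L x f (λ c → proj₁ (child-tree c t)) ts)
          (at-< (discover L x) i (discover-⊑ L x i e))
          (≤-trans D≤ (≤-reflexive (+-suc i k)))
    in L′ , visit e f b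

  bfs : ∀ r → TreeAt G D r → ∃[ L ] BFS D 0 [ r ] L
  bfs r t = bfs-exists (length D) 0 [ r ] ([] ∷ []) (t ∷ []) z≤n ≤-refl

concat-word : ∀ {σ} {G : Graph σ} {D : Dag (#V G)} {p q s} (t : TreeAt G D p) →
              D at p ≡ just (concat q s) → (l : TreeAt G D q) (r : TreeAt G D s) →
              word t ≡ word l ++ word r
concat-word ⟨ edge e′ _ ⟩   e _ _ with () ← trans (sym e) e′
concat-word ⟨ eps e′ ⟩      e _ _ with () ← trans (sym e) e′
concat-word ⟨ concat e′ l′ r′ ⟩ e l r with refl ← trans (sym e) e′ =
  cong₂ _++_ (proj₁ (tree-unique l′ (root-tree l))) (proj₁ (tree-unique r′ (root-tree r)))

module SLP {σ} {G : Graph σ} {D : Dag (#V G)} {r : ℕ} (t : TreeAt G D r) {L : List ℕ}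
           (members : ∀ q → q ∈ L ⇔ Star (Child D) r q) where

  private module M q = Equivalence (members q)

  Var : Set
  Var = Fin (length L)

  -- Right-hand sides are specified by the node they come from, with children given by their numbers
  -- in `L`, so that later case analyses need not unfold `rule`.
  data Production (j : Var) : List (Var ⊎ Fin σ) → Set where
    edge   : ∀ {u v a} → D at lookup L j ≡ just (edge u v) → arc G u v ≡ just a →
             Production j [ inj₂ a ]
    eps    : ∀ {u} → D at lookup L j ≡ just (eps u) → Production j []
    concat : ∀ {y z} → D at lookup L j ≡ just (concat (lookup L y) (lookup L z)) →
             Production j (inj₁ y ∷ inj₁ z ∷ [])

  subtree : ∀ j → TreeAt G D (lookup L j)
  subtree j = descend (M.to _ (∈-lookup j)) t

  rule : ∀ j → ∃[ γ ] Production j γ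
  rule j with subtree j
  ... | ⟨ edge e a ⟩ = _ , edge e a
  ... | ⟨ eps e ⟩    = _ , eps e
  ... | ⟨ concat {q = q} {s} e _ _ ⟩ = _ , concat {y = index q∈L} {index s∈L}
    (subst₂ (λ y z → D at lookup L j ≡ just (concat y z)) (lookup-index q∈L) (lookup-index s∈L) e)
    where
    r⇝ = M.to _ (∈-lookup j)
    q∈L = M.from q (r⇝ ◅◅ (left e ◅ ε))
    s∈L = M.from s (r⇝ ◅◅ (right e ◅ ε))

  r∈L : r ∈ L
  r∈L = M.from r ε

  production : Var → Var × List (Var ⊎ Fin σ)
  production j = j , proj₁ (rule j)

  slp : CFG σ
  slp = record { #N = length L ; start = index r∈L ; P = tabulate production }

  rule-used : ∀ {j γ} → (j , γ) ∈ P slp → Production j γ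
  rule-used j→γ with ∈-tabulate⁻ j→γ
  ... | j , refl = proj₂ (rule j)

  value : Sym slp → List (Fin σ)
  value (inj₁ j) = word (subtree j)
  value (inj₂ a) = [ a ]

  values : List (Sym slp) → List (Fin σ)
  values = concatMap value

  values-++ : ∀ α {β} → values (α ++ β) ≡ values α ++ values β
  values-++ []      = refl
  values-++ (x ∷ α) = trans (cong (value x ++_) (values-++ α)) (sym (++-assoc (value x) _ _))

  values-terminal : ∀ w → values (map inj₂ w) ≡ w
  values-terminal []      = refl
  values-terminal (a ∷ w) = cong (a ∷_) (values-terminal w)

  production-value : ∀ {j γ} → Production j γ → word (subtree j) ≡ values γ
  production-value {j} (edge e a) = proj₁ (tree-unique (root-tree (subtree j)) (edge e a))
  production-value {j} (eps e)    = proj₁ (tree-unique (root-tree (subtree j)) (eps e))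
  production-value {j} (concat {y} {z} e) =
    trans (concat-word (subtree j) e (subtree y) (subtree z))
      (cong (word (subtree y) ++_) (sym (++-identityʳ _)))

  -- Rewriting preserves the value of a sentential form, so that the start
  -- symbol generates no word but its value.
  rewrite-value : ∀ {α β} → Rewrites slp α β → values α ≡ values β
  rewrite-value (rewrite-at {A} {γ} α β A→γ) = begin
    values (α ++ inj₁ A ∷ β)                     ≡⟨ values-++ α ⟩
    values α ++ word (subtree A) ++ values β     ≡⟨ cong (λ w → values α ++ w ++ values β)
                                                       (production-value (rule-used A→γ)) ⟩
    values α ++ values γ ++ values β             ≡⟨ cong (values α ++_) (values-++ γ) ⟨
    values α ++ values (γ ++ β)                  ≡⟨ values-++ α ⟨
    values (α ++ γ ++ β)                         ∎
    where open ≡-Reasoning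

  rewrites-value : ∀ {α β} → Star (Rewrites slp) α β → values α ≡ values β
  rewrites-value ε       = refl
  rewrites-value (x ◅ d) = trans (rewrite-value x) (rewrites-value d)

  -- Induction on the unfolding: the production at `j` has the shape of the root, and its
  -- nonterminals derive the words of the two subtrees.
  derive : ∀ {p u v π w n} → Tree G D p u v π w n → ∀ j → lookup L j ≡ p → 𝓛 slp j w
  derive tr j refl = apply (∈-tabulate⁺ j) (expand tr (proj₂ (rule j)))
    where
    expand : ∀ {u v π w n γ} → Tree G D (lookup L j) u v π w n → Production j γ →
             Star (Rewrites slp) γ (map inj₂ w)
    expand (edge e a)     (edge f b) with refl ← trans (sym e) f with refl ← trans (sym a) b = ε
    expand (edge e _)     (eps f)     with () ← trans (sym e) f
    expand (edge e _)     (concat f)  with () ← trans (sym e) f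
    expand (eps e)        (edge f _)  with () ← trans (sym e) f
    expand (eps e)        (eps f)     = ε
    expand (eps e)        (concat f)  with () ← trans (sym e) f
    expand (concat e _ _) (edge f _)  with () ← trans (sym e) f
    expand (concat e _ _) (eps f)     with () ← trans (sym e) f
    expand (concat {q = q} {s} e l r) (concat {y} {z} f) with refl ← trans (sym e) f =
      _⊗ʷ_ {α = [ inj₁ y ]} {β = [ inj₁ z ]} (derive l y refl) (derive r z refl)

  -- The size of the unfolding is the measure behind acyclicity; `tree-unique` identifies the child
  -- of the parent's tree with the tree chosen by `subtree`.
  uses-smaller : ∀ {X Y} → Uses slp X Y → size (subtree Y) < size (subtree X)
  uses-smaller {X} {Y} (γ , X→γ , Y∈γ) =
    let (t′ , lt) = child-tree (child (rule-used X→γ) Y∈γ) (subtree X)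
    in ≤-<-trans (≤-reflexive (proj₂ (tree-unique (root-tree (subtree Y)) (root-tree t′)))) lt
    where
    child : ∀ {γ} → Production X γ → inj₁ Y ∈ γ → Child D (lookup L X) (lookup L Y)
    child (edge _ _) (here ())
    child (edge _ _) (there ())
    child (concat e) (here refl)         = left e
    child (concat e) (there (here refl)) = right e

  uses⁺-smaller : ∀ {X Y} → TransClosure (Uses slp) X Y → size (subtree Y) < size (subtree X)
  uses⁺-smaller TC.[ x ]   = uses-smaller x
  uses⁺-smaller (x TC.∷ c) = <-trans (uses⁺-smaller c) (uses-smaller x)

  isSLP : IsSLP slp (word t)
  isSLP = record
    { one-production = ↭-reflexive (map-tabulate production proj₁)
    ; acyclic        = λ X X⇝X → <-irrefl refl (uses⁺-smaller X⇝X)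
    ; generates      = λ v → mk⇔ (λ d → sym (value-is d))
                         λ { refl → derive (root-tree t) _ (sym (lookup-index r∈L)) }
    }
    where
    value-is : ∀ {v} → 𝓛 slp (start slp) v → word t ≡ v
    value-is {v} d = begin
      word t                                   ≡⟨ proj₁ (tree-unique at-start (root-tree (subtree (start slp)))) ⟩
      word (subtree (start slp))               ≡⟨ ++-identityʳ _ ⟨
      values [ inj₁ (start slp) ]              ≡⟨ rewrites-value d ⟩
      values (map inj₂ v)                      ≡⟨ values-terminal v ⟩
      v                                        ∎
      where
      open ≡-Reasoning
      at-start = subst (λ p → Tree G D p _ _ _ _ _) (lookup-index r∈L) (root-tree t)

-- The programs

-- Of all nodes those of kind concat take most time, 17 instructions.
extract : Program
extract =
  -- 0: visit the node in register 0; register 1 is the height of the stack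
  const 2 0 ∷ read 3 nodes 0 2 ∷ inc 2 ∷ jump-if-≡ 3 2 15 ∷
  read 4 nodes 0 2 ∷ inc 2 ∷ read 5 nodes 0 2 ∷ jump-if-≡ 3 2 11 ∷
  emit 4 ∷ emit 5 ∷ jump 15 ∷
  -- 11: concat
  store 0 1 5 ∷ inc 1 ∷ copy 0 4 ∷ jump 0 ∷
  -- 15: pop
  const 2 0 ∷ jump-if-≡ 1 2 20 ∷ dec 1 ∷ load 0 0 1 ∷ jump 0 ∷ []

-- Breadth-first search.  Membership in the queue `work 0` is tested with the
-- sparse array `work 1`, whose initial contents are arbitrary: q has been seen
-- iff work 1 [q] is a position below the length of the queue that holds q.
-- A node takes at most 47 instructions.
compress : Program
compress =
  store 0 1 0 ∷ store 1 0 1 ∷ emit 2 ∷ inc 2 ∷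
  -- 4: process the node at position (register 1) of the queue of length (register 2)
  jump-if-≡ 1 2 46 ∷ load 0 0 1 ∷ emit 1 ∷ const 4 0 ∷ read 3 nodes 0 4 ∷
  inc 4 ∷ jump-if-≡ 3 4 21 ∷ inc 4 ∷ jump-if-≡ 3 4 24 ∷
  -- 13: edge
  read 5 nodes 0 4 ∷ const 4 1 ∷ read 3 nodes 0 4 ∷ read 5 labels 3 5 ∷
  emit 4 ∷ emit 4 ∷ emit 5 ∷ jump 44 ∷
  -- 21: eps
  const 4 0 ∷ emit 4 ∷ jump 44 ∷
  -- 24: concat; 26: visit the child in cell (register 4) of the node
  emit 4 ∷ const 4 1 ∷
  read 3 nodes 0 4 ∷ load 5 1 3 ∷ jump-if-< 5 2 34 ∷
  -- 29: enqueue
  store 0 2 3 ∷ store 1 3 2 ∷ copy 5 2 ∷ inc 2 ∷ jump 37 ∷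
  -- 34: is the child already in the queue?
  load 6 0 5 ∷ jump-if-≡ 6 3 37 ∷ jump 29 ∷
  -- 37: emit the number of the child
  const 6 0 ∷ emit 6 ∷ emit 5 ∷ const 6 2 ∷ jump-if-≡ 4 6 44 ∷ inc 4 ∷ jump 26 ∷
  -- 44: next node
  inc 1 ∷ jump 4 ∷ []

-- Bounded runs of the machine.

update-same : ∀ (f : ℕ → ℕ) i x → (f [ i ≔ x ]) i ≡ x
update-same f i x rewrite dec-true (i ℕ.≟ i) refl = refl

update-other : ∀ (f : ℕ → ℕ) {i j} x → i ≢ j → (f [ i ≔ x ]) j ≡ f j
update-other f {i} {j} x i≢j rewrite dec-false (i ℕ.≟ j) i≢j = refl

module Machine (inp : Input → ℕ → ℕ → ℕ) (prog : Program) where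

  -- A bound instead of the exact time lets branches of different length be padded to a common cost
  -- by `relax`.
  Computes : State → ℕ → List ℕ → Set
  Computes s b o = ∃[ t ] Runs inp prog s t o × t ≤ b

  relax : ∀ {s b b′ o} → b ≤ b′ → Computes s b o → Computes s b′ o
  relax b≤b′ (t , runs , t≤b) = t , runs , ≤-trans t≤b b≤b′

  halted : ∀ {s b} → prog at State.pc s ≡ nothing → Computes s b (State.out s)
  halted e = 0 , halt e , z≤n

  rewriting : ∀ {pc r w out out′ b o} → out ≡ out′ →
              Computes (state pc r w out) b o → Computes (state pc r w out′) b o
  rewriting refl c = c

  module _ {pc : ℕ} {r : ℕ → ℕ} {w : ℕ → ℕ → ℕ} {out : List ℕ} {b : ℕ} {o : List ℕ} where

    tick : ∀ {i} → prog at pc ≡ just i →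
           Computes (exec inp i (state pc r w out)) b o → Computes (state pc r w out) (suc b) o
    tick e (t , runs , t≤b) = suc t , next e runs , s≤s t≤b

    -- This and the next two are `tick` with the transferred value replaced by a known one, so that
    -- later registers and outputs stay readable.
    reading : ∀ {x t i j k} → prog at pc ≡ just (read x t i j) → inp t (r i) (r j) ≡ k →
              Computes (state (suc pc) (r [ x ≔ k ]) w out) b o → Computes (state pc r w out) (suc b) o
    reading e refl = tick e

    loading : ∀ {x k i y} → prog at pc ≡ just (load x k i) → w k (r i) ≡ y →
              Computes (state (suc pc) (r [ x ≔ y ]) w out) b o → Computes (state pc r w out) (suc b) o
    loading e refl = tick e

    emitting : ∀ {x k} → prog at pc ≡ just (emit x) → r x ≡ k →
               Computes (state (suc pc) r w (out ∷ʳ k)) b o → Computes (state pc r w out) (suc b) o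
    emitting e refl = tick e

    jump≡ : ∀ {x y l} → prog at pc ≡ just (jump-if-≡ x y l) → r x ≡ r y →
            Computes (state l r w out) b o → Computes (state pc r w out) (suc b) o
    jump≡ {x} {y} {l} e x≡y c = tick e
      (subst (λ z → Computes (state (if z then l else suc pc) r w out) b o)
        (sym (trans (cong (_≡ᵇ r y) x≡y) (dec-true (r y ℕ.≟ r y) refl))) c)

    skip≡ : ∀ {x y l} → prog at pc ≡ just (jump-if-≡ x y l) → r x ≢ r y →
            Computes (state (suc pc) r w out) b o → Computes (state pc r w out) (suc b) o
    skip≡ {x} {y} {l} e x≢y c = tick e
      (subst (λ z → Computes (state (if z then l else suc pc) r w out) b o)
        (sym (dec-false (r x ℕ.≟ r y) x≢y)) c)

    jump< : ∀ {x y l} → prog at pc ≡ just (jump-if-< x y l) → r x < r y →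
            Computes (state l r w out) b o → Computes (state pc r w out) (suc b) o
    jump< {x} {y} {l} e x<y c = tick e
      (subst (λ z → Computes (state (if z then l else suc pc) r w out) b o)
        (sym (dec-true (r x ℕ.<? r y) x<y)) c)

    skip< : ∀ {x y l} → prog at pc ≡ just (jump-if-< x y l) → ¬ r x < r y →
            Computes (state (suc pc) r w out) b o → Computes (state pc r w out) (suc b) o
    skip< {x} {y} {l} e x≮y c = tick e
      (subst (λ z → Computes (state (if z then l else suc pc) r w out) b o)
        (sym (dec-false (r x ℕ.<? r y) x≮y)) c)

-- Correctness and time of extraction.

encodePath-++ : ∀ {n} (π ρ : List (Fin n × Fin n)) → encodePath (π ++ ρ) ≡ encodePath π ++ encodePath ρ
encodePath-++ π ρ = concatMap-++ _ π ρ

module Extract {σ} {G : Graph σ} {D : Dag (#V G)} {inp : Input → ℕ → ℕ → ℕ} (stores : Stores G D inp) where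

  open Machine inp extract
  open Stores stores

  -- Written with a continuation `k` for the moment when the program is about to pop: the stack has
  -- its old height and its old contents below it. The pop itself is charged to the enclosing
  -- `concat` or to the end of the run.
  visiting : ∀ {p u v π w n} → Tree G D p u v π w n → ∀ {r wk out b o} → r 0 ≡ p →
    (∀ r′ wk′ → r′ 1 ≡ r 1 → (∀ j → j < r 1 → wk′ 0 j ≡ wk 0 j) →
      Computes (state 15 r′ wk′ (out ++ encodePath π)) b o) →
    Computes (state 0 r wk out) (n * 17 + b) o
  visiting (edge {p} e _) {out = out} {b} {o} refl k = relax (+-monoˡ-≤ b (m≤m+n 11 6)) $
    tick refl $ reading refl (dag-cells {p} {i = 0} e refl) $ tick refl $ skip≡ refl (λ ()) $
    reading refl (dag-cells {p} {i = 1} e refl) $ tick refl $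
    reading refl (dag-cells {p} {i = 2} e refl) $ skip≡ refl (λ ()) $
    tick refl $ tick refl $ tick refl $
    rewriting (sym (++-assoc out _ _)) (k _ _ refl λ _ _ → refl)
  visiting (eps {p} e) {out = out} {b} {o} refl k = relax (+-monoˡ-≤ b (m≤m+n 4 13)) $
    tick refl $ reading refl (dag-cells {p} {i = 0} e refl) $ tick refl $ jump≡ refl refl $
    rewriting (++-identityʳ out) (k _ _ refl λ _ _ → refl)
  visiting (concat {p} {q} {s} {π = π} {ρ} {m = m} {n} e t₁ t₂) {r} {wk} {out} {b} {o} refl k =
    relax (≤-reflexive (cost m n b)) $
    tick refl $ reading refl (dag-cells {p} {i = 0} e refl) $ tick refl $ skip≡ refl (λ ()) $
    reading refl (dag-cells {p} {i = 1} e refl) $ tick refl $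
    reading refl (dag-cells {p} {i = 2} e refl) $ jump≡ refl refl $
    -- The right child is pushed and the left one visited. The 12 instructions up to here and the 5
    -- of the later pop make 17.
    tick refl $ tick refl $ tick refl $ tick refl $
    visiting t₁ refl λ r₁ wk₁ sp₁ below₁ →
    tick refl $ skip≡ refl (λ z → 1+n≢0 (trans (sym sp₁) z)) $ tick refl $
    loading {y = s} refl
      (trans (cong (λ h → wk₁ 0 (pred h)) sp₁)
        (trans (below₁ (r 1) ≤-refl) (update-same (wk 0) (r 1) s))) $
    tick refl $
    visiting t₂ refl λ r₂ wk₂ sp₂ below₂ →
    let sp₁′ = cong pred sp₁ in
    rewriting
      (trans (cong (out ++_) (encodePath-++ π ρ)) (sym (++-assoc out _ _)))
      (k r₂ wk₂ (trans sp₂ sp₁′) λ j j<h →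
        trans (below₂ j (<-≤-trans j<h (≤-reflexive (sym sp₁′))))
          (trans (below₁ j (m≤n⇒m≤1+n j<h)) (update-other (wk 0) s (<⇒≢ j<h ∘ sym))))
    where
    cost : ∀ m n b → 12 + (m * 17 + (5 + (n * 17 + b))) ≡ suc (m + n) * 17 + b
    cost = solve-∀

  extracting : ∀ {p u v π w n} → Tree G D p u v π w n → ∀ scratch →
               Computes (initial p scratch) (n * 19) (encodePath π)
  extracting {n = n} t scratch = relax bound (visiting t refl λ r′ wk′ sp≡ _ →
    tick {b = 1} refl (jump≡ refl sp≡ (halted refl)))
    where
    open ≤-Reasoning
    bound : n * 17 + 2 ≤ n * 19
    -- The last pop finds the stack empty and takes 2 instructions, charged to the root.
    bound = begin
      n * 17 + 2      ≤⟨ +-monoʳ-≤ (n * 17) (*-monoˡ-≤ 2 (size>0 t)) ⟩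
      n * 17 + n * 2  ≡⟨ *-distribˡ-+ n 17 2 ⟨
      n * 19          ∎

-- Correctness and time of compression.

record Queue (dense sparse : ℕ → ℕ) (L : List ℕ) : Set where
  field
    unique   : Unique L
    -- Only cells belonging to elements of `L` are constrained, so the arrays may start with
    -- arbitrary contents.
    position : ∀ k {q} → L at k ≡ just q → dense k ≡ q × sparse q ≡ k

open Queue

enqueue : ∀ {dense sparse L q} → Queue dense sparse L → q ∉ L →
          Queue (dense [ length L ≔ q ]) (sparse [ q ≔ length L ]) (L ∷ʳ q)
enqueue {dense} {sparse} {L} {q} Q q∉L = record
  { unique   = unique-∷ʳ (unique Q) q∉L
  ; position = pos
  }
  where
  pos : ∀ k {s} → (L ∷ʳ q) at k ≡ just s → (dense [ length L ≔ q ]) k ≡ s × (sparse [ q ≔ length L ]) s ≡ k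
  pos k e with at-∷ʳ L k e
  ... | inj₂ (refl , refl) = update-same dense (length L) q , update-same sparse q (length L)
  ... | inj₁ e′ with d , s ← position Q k e′ =
    trans (update-other dense q (<⇒≢ (at-< L k e′) ∘ sym)) d ,
    trans (update-other sparse {q} (length L) λ { refl → q∉L (at⇒∈ L k e′) }) s

module Compress {σ} {G : Graph σ} {D : Dag (#V G)}
                {inp : Input → ℕ → ℕ → ℕ} (stores : Stores G D inp)
                {r : ℕ} (t : TreeAt G D r) {L′ : List ℕ} (search : BFS D 0 [ r ] L′) where

  open Machine inp compress
  open Stores stores
  open SLP t (bfs-members search)

  L′-unique : Unique L′
  L′-unique = bfs-unique D search ([] ∷ [])

  -- Queues only grow and the final one has no duplicates, so a position found during the search is
  -- already the final number.
  at-number : ∀ {L} j k → L ⊑ L′ → L at k ≡ just (lookup L′ j) → k ≡ toℕ j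
  at-number j k L⊑L′ e = at-injective k (toℕ j) L′-unique (L⊑L′ k e) (at-lookup L′ j)

  -- The continuation once the symbol of a child has been written. Register 6 then holds 2, the cell
  -- of the right child, against which register 4 is compared next.
  Child-done : List ℕ → (p i k a : ℕ) → List ℕ → ℕ → List ℕ → Set
  Child-done L p i k a out b o = ∀ reg wk → reg 0 ≡ p → reg 1 ≡ i → reg 2 ≡ length L →
    reg 4 ≡ k → reg 6 ≡ 2 → Queue (wk 0) (wk 1) L → Computes (state 41 reg wk (out ∷ʳ 0 ∷ʳ a)) b o

  enqueuing : ∀ {reg wk L p i k a q out b o} → Queue (wk 0) (wk 1) L → q ∉ L →
    reg 0 ≡ p → reg 1 ≡ i → reg 2 ≡ length L → reg 3 ≡ q → reg 4 ≡ k → length L ≡ a →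
    Child-done (L ∷ʳ q) p i k a out b o → Computes (state 29 reg wk out) (9 + b) o
  enqueuing {wk = wk} {L} Q q∉L r0 r1 r2 r3 r4 refl cont =
    tick refl $ tick refl $ tick refl $ tick refl $ tick refl $
    tick refl $ emitting refl refl $ emitting refl r2 $ tick refl $
    cont _ _ r0 r1 (trans (cong suc r2) (sym (length-∷ʳ L))) r4 refl
      (subst₂ (λ n q → Queue (wk 0 [ n ≔ q ]) (wk 1 [ q ≔ n ]) _) (sym r2) (sym r3) (enqueue Q q∉L))

  -- For an unseen child the sparse cell is either out of range or in range by accident; in the
  -- latter case the dense cell holds a listed node, hence not this child. This is the longest
  -- branch: 6 instructions and the 9 of `enqueuing`.
  child : ∀ {reg wk L p i k j out b o} → Queue (wk 0) (wk 1) L → add L (lookup L′ j) ⊑ L′ →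
    reg 0 ≡ p → reg 1 ≡ i → reg 2 ≡ length L → reg 4 ≡ k → inp nodes p k ≡ lookup L′ j →
    Child-done (add L (lookup L′ j)) p i k (toℕ j) out b o →
    Computes (state 26 reg wk out) (15 + b) o
  child {reg} {wk} {L} {j = j} {b = b} Q sub r0 r1 r2 r4 cell cont
    with DecMembership._∈?_ ℕ._≟_ (lookup L′ j) L
  ... | yes q∈L =
    relax (+-monoˡ-≤ b (m≤m+n 9 6)) $
    reading refl (trans (cong₂ (inp nodes) r0 r4) cell) $ loading refl (proj₂ here′) $
    jump< refl (<-≤-trans (at-< L _ e) (≤-reflexive (sym r2))) $
    loading refl (proj₁ here′) $ jump≡ refl refl $
    tick refl $ emitting refl refl $ emitting refl (at-number j _ sub e) $ tick refl $
    cont _ _ r0 r1 r2 r4 refl Q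
    where
    e     = at-index q∈L
    here′ = position Q (toℕ (index q∈L)) e
  ... | no q∉L with wk 1 (lookup L′ j) ℕ.<? reg 2
  ...   | no s≮n =
    relax (+-monoˡ-≤ b (m≤m+n 12 3)) $
    reading refl (trans (cong₂ (inp nodes) r0 r4) cell) $ tick refl $ skip< refl s≮n $
    enqueuing Q q∉L r0 r1 r2 refl r4 (at-number j _ sub (at-length L)) cont
  ...   | yes s<n =
    reading refl (trans (cong₂ (inp nodes) r0 r4) cell) $ tick refl $ jump< refl s<n $
    tick refl $ skip≡ refl absent $ tick refl $
    enqueuing Q q∉L r0 r1 r2 refl r4 (at-number j _ sub (at-length L)) cont
    where
    slot = wk 1 (lookup L′ j)
    s<L : slot < length L
    s<L = <-≤-trans s<n (≤-reflexive r2)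
    e : L at slot ≡ just (lookup L (fromℕ< s<L))
    e = subst (λ k → L at k ≡ just (lookup L (fromℕ< s<L))) (toℕ-fromℕ< s<L) (at-lookup L (fromℕ< s<L))
    absent : wk 0 slot ≢ lookup L′ j
    absent eq = q∉L (subst (_∈ L) (trans (sym (proj₁ (position Q slot e))) eq) (at⇒∈ L slot e))

  encodeRule : Var × List (Var ⊎ Fin σ) → List ℕ
  encodeRule (X , γ) = toℕ X ∷ length γ ∷ concatMap (encodeSym slp) γ

  emitted : ∀ {x ys} out {o : List ℕ} → out ++ x ∷ ys ≡ o → (out ∷ʳ x) ++ ys ≡ o
  emitted out e = trans (∷ʳ-++ out _ _) e

  mutual

    -- The productions not yet dropped are both the output still owed and the time budget, 47
    -- instructions each; the 1 is the test that ends the loop.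
    searching : ∀ {i L} → BFS D i L L′ → ∀ {reg wk out o} → Queue (wk 0) (wk 1) L →
      reg 1 ≡ i → reg 2 ≡ length L → out ++ concatMap encodeRule (drop i (P slp)) ≡ o →
      Computes (state 4 reg wk out) (length (drop i (P slp)) * 47 + 1) o
    searching done {wk = wk} {out} Q r1 r2 refl =
      relax (m≤n+m 1 _) $ jump≡ refl (trans r1 (sym r2)) $
      subst (Computes _ 0) (sym (trans (cong (λ ps → out ++ concatMap encodeRule ps)
        (drop-all (length L′) _ (≤-reflexive (length-tabulate production)))) (++-identityʳ out))) (halted refl)
    searching (visit {i} {L} e f b) Q r1 r2 result =
      let i<L′ = at-< L′ i (bfs-⊑ D (visit e f b) i e)
      in numbered (fromℕ< i<L′) (sym (toℕ-fromℕ< i<L′)) e f b Q r1 r2 result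

    -- Replaces the position by an element of `Fin`, so that `drop-tabulate` exposes the production
    -- to be written.
    numbered : ∀ j {i L p x} → i ≡ toℕ j → L at i ≡ just p → D at p ≡ just x →
      BFS D (suc i) (discover L x) L′ → ∀ {reg wk out o} → Queue (wk 0) (wk 1) L →
      reg 1 ≡ i → reg 2 ≡ length L → out ++ concatMap encodeRule (drop i (P slp)) ≡ o →
      Computes (state 4 reg wk out) (length (drop i (P slp)) * 47 + 1) o
    numbered j refl e f b Q r1 r2 result
      with refl ← just-injective (trans (sym (at-lookup L′ j)) (bfs-⊑ D (visit e f b) (toℕ j) e))
      rewrite drop-tabulate production j =
      processing e f b (proj₂ (rule j)) Q r1 r2 result

    processing : ∀ {j L x γ} → L at toℕ j ≡ just (lookup L′ j) → D at lookup L′ j ≡ just x →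
      BFS D (suc (toℕ j)) (discover L x) L′ → Production j γ →
      ∀ {reg wk out o} → Queue (wk 0) (wk 1) L → reg 1 ≡ toℕ j → reg 2 ≡ length L →
      out ++ encodeRule (j , γ) ++ concatMap encodeRule (drop (suc (toℕ j)) (P slp)) ≡ o →
      Computes (state 4 reg wk out) (47 + (length (drop (suc (toℕ j)) (P slp)) * 47 + 1)) o
    processing {j} {L} e f b (edge {a = a} f′ arc≡) {wk = wk} {out} Q r1 r2 result
      with refl ← trans (sym f) f′ =
      relax (+-monoˡ-≤ _ (m≤m+n 19 28)) $
      skip≡ refl (λ i≡n → <⇒≢ (at-< L (toℕ j) e) (trans (sym r1) (trans i≡n r2))) $
      loading refl (trans (cong (wk 0) r1) (proj₁ (position Q (toℕ j) e))) $ emitting refl r1 $ tick refl $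
      reading refl (dag-cells {i = 0} f refl) $ tick refl $ skip≡ refl (λ ()) $ tick refl $ skip≡ refl (λ ()) $
      reading refl (dag-cells {i = 2} f refl) $ tick refl $ reading refl (dag-cells {i = 1} f refl) $
      -- Register 4 holds 1, written first as the length of the right-hand side and then as the tag
      -- of a terminal.
      reading refl (label-cells arc≡) $ emitting refl refl $ emitting refl refl $ emitting refl refl $ tick refl $
      tick refl $ tick refl $
      searching b Q (cong suc r1) r2 (emitted _ $ emitted _ $ emitted _ $ emitted out result)
    processing {j} {L} e f b (eps f′) {wk = wk} {out} Q r1 r2 result
      with refl ← trans (sym f) f′ =
      relax (+-monoˡ-≤ _ (m≤m+n 12 35)) $
      skip≡ refl (λ i≡n → <⇒≢ (at-< L (toℕ j) e) (trans (sym r1) (trans i≡n r2))) $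
      loading refl (trans (cong (wk 0) r1) (proj₁ (position Q (toℕ j) e))) $ emitting refl r1 $ tick refl $
      reading refl (dag-cells {i = 0} f refl) $ tick refl $ jump≡ refl refl $
      tick refl $ emitting refl refl $ tick refl $
      tick refl $ tick refl $
      searching b Q (cong suc r1) r2 (emitted _ $ emitted out result)
    processing {j} {L} e f b (concat {y} {z} f′) {wk = wk} {out} Q r1 r2 result
      with refl ← trans (sym f) f′ =
      skip≡ refl (λ i≡n → <⇒≢ (at-< L (toℕ j) e) (trans (sym r1) (trans i≡n r2))) $
      loading refl (trans (cong (wk 0) r1) (proj₁ (position Q (toℕ j) e))) $ emitting refl r1 $ tick refl $
      reading refl (dag-cells {i = 0} f refl) $ tick refl $ skip≡ refl (λ ()) $ tick refl $ jump≡ refl refl $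
      -- The code 2 of a `concat` node doubles as the length of the right-hand side. The cost is 11
      -- + 15 + 3 + 15 + 3 = 47.
      emitting refl refl $ tick refl $
      child Q (λ k e → bfs-⊑ D b k (add-⊑ (add L (lookup L′ y)) (lookup L′ z) k e))
        refl r1 r2 refl (dag-cells {i = 1} f refl) λ reg₁ wk₁ r0₁ r1₁ r2₁ r4₁ r6₁ Q₁ →
      skip≡ refl (λ 4≡6 → 1≢2 (trans (sym r4₁) (trans 4≡6 r6₁))) $ tick refl $ tick refl $
      child Q₁ (bfs-⊑ D b)
        r0₁ r1₁ r2₁ (cong suc r4₁) (dag-cells {i = 2} f refl) λ reg₂ wk₂ r0₂ r1₂ r2₂ r4₂ r6₂ Q₂ →
      jump≡ refl (trans r4₂ (sym r6₂)) $ tick refl $ tick refl $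
      searching b Q₂ (cong suc r1₂) r2₂
        (emitted _ $ emitted _ $ emitted _ $ emitted _ $ emitted _ $ emitted out result)
      where
      1≢2 : 1 ≢ 2
      1≢2 ()

  compressing : ∀ scratch → Computes (initial r scratch) (length L′ * 52) (encodeSLP slp)
  compressing scratch = relax bound $
    -- Register 2 still holds 0, the position of `r` and so the number of the start symbol.
    tick refl $ tick refl $ emitting refl (at-number (index r∈L) 0 first (cong just (lookup-index r∈L))) $ tick refl $
    searching search (record { unique = [] ∷ [] ; position = pos }) refl refl refl
    where
    first : [ r ] ⊑ L′
    first = bfs-⊑ D search
    pos : ∀ k {q} → [ r ] at k ≡ just q → _
    pos zero          refl = refl , update-same (scratch 1) r 0
    pos (suc zero)    ()
    pos (suc (suc _)) ()
    open ≤-Reasoning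
    bound : 4 + (length (P slp) * 47 + 1) ≤ length L′ * 52
    -- The 4 initial instructions and the final test are charged to the root, raising 47 to 52.
    bound = begin
      4 + (length (P slp) * 47 + 1)  ≡⟨ cong (λ m → 4 + (m * 47 + 1)) (length-tabulate production) ⟩
      4 + (length L′ * 47 + 1)       ≡⟨ lemma (length L′) ⟩
      1 * 5 + length L′ * 47         ≤⟨ +-monoˡ-≤ (length L′ * 47) (*-monoˡ-≤ 5 (at-< L′ 0 (first 0 refl))) ⟩
      length L′ * 5 + length L′ * 47 ≡⟨ *-distribˡ-+ (length L′) 5 47 ⟨
      length L′ * 52                 ∎
      where
      lemma : ∀ m → 4 + (m * 47 + 1) ≡ 1 * 5 + m * 47
      lemma = solve-∀

-- Choice of the constants and assembly.

isolated? : ∀ {σ} (𝒢 : CFG σ) → Dec (ε-Isolated 𝒢)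
isolated? 𝒢 =
  ((start 𝒢 , []) ∈? P 𝒢) →-dec
  all? λ A → all? λ B → all? λ C → ((A , inj₁ B ∷ inj₁ C ∷ []) ∈? P 𝒢) →-dec
    (¬? (B Fin.≟ start 𝒢) ×-dec ¬? (C Fin.≟ start 𝒢))
  where open DecMembership (≡-dec Fin._≟_ (List.≡-dec (Sum.≡-dec Fin._≟_ Fin._≟_)))

SizeBound : ∀ {σ} → Kind → CFG σ → ℕ → Set
SizeBound κ 𝒢 B = ∀ {G D A u v p π w ℓ n} → ℓ < #N 𝒢 → Witness 𝒢 G D κ A u v p π w ℓ n →
                  n ≤ B * suc (length π)

-- The factor depends on the grammar alone but must be absolute when ε is isolated; deciding
-- isolation selects the applicable estimate.
size-bound : ∀ {σ} κ (𝒢 : CFG σ) → ∃[ B ] (ε-Isolated 𝒢 → B ≤ 2) × SizeBound κ 𝒢 B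
size-bound lin 𝒢 = 2 , (λ _ → ≤-refl) , λ {π = π} _ d →
  ≤-trans (lin-size d) (≤-trans (n≤1+n _) (≤-reflexive (sym (*-suc 2 (length π)))))
size-bound sat 𝒢 with isolated? 𝒢
... | yes iso = 2 , (λ _ → ≤-refl) , λ {π = π} _ d → small (length π) (isolated-size iso d)
  where
  small : ∀ k {n} {Q R : Set} → (Q × R × n ≤ 1) ⊎ suc n ≤ 2 * k → n ≤ 2 * suc k
  small k (inj₁ (_ , _ , n≤1)) = ≤-trans n≤1 (s≤s z≤n)
  small k (inj₂ lt)            = ≤-trans (<⇒≤ lt) (*-monoʳ-≤ 2 (n≤1+n k))
... | no ¬iso = sizeFactor (#N 𝒢) , (λ iso → contradiction iso ¬iso) , sat-size

theorem4p3 :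
    Σ[ extract ∈ Program ] Σ[ compress ∈ Program ] Σ[ c ∈ ℕ ]
    (∀ {σ} (κ : Kind) (𝒢 : CFG σ) → NormalForm κ 𝒢 →
     Σ[ d ∈ ℕ ] (ε-Isolated 𝒢 → d ≤ c) ×
     (∀ (G : Graph σ) (ix : Index κ 𝒢 G) →
      let S = SWDIndex ix in
      #roots S ≤ c * #true ix ×
      space S ≤ c * #true ix + c * #nodes S ×
      #nodes S ≤ c * #true ix ×
      Unique (dag S) ×
      (∀ A u v → T (M ix A u v) →
       ∃[ r ] root S (A , u , v) ≡ just r ×
       (∃[ π ] ∃[ w ] Denotes (dag S) r π × Path G u v π w × 𝓛 𝒢 A w ×
        Outputs G (dag S) extract r (d * suc (length π)) (encodePath π) ×
        (∃[ m ] SubDagSize (dag S) r m ×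
         (∃[ H ] IsSLP H w ×
          Outputs G (dag S) compress r (c * m) (encodeSLP H)))))))
-- 52 is the cost of compression per node. It also covers 3 words per node, 2 nodes per entry, and 2
-- * 19 = 38 for extraction with ε isolated.
theorem4p3 = extract , compress , 52 , λ κ 𝒢 _ →
  let (B , iso⇒B≤2 , bounded) = size-bound κ 𝒢 in
  B * 19 ,
  (λ iso → ≤-trans (*-monoˡ-≤ 19 (iso⇒B≤2 iso)) (m≤m+n 38 14)) ,
  λ G ix →
  let S     = SWDIndex ix
      sound = swd-sound (history ix)
      roots : #roots S ≤ 52 * #true ix
      roots = ≤-trans (#roots≤#true ix) (m≤n*m (#true ix) 52)
  in
  roots ,
  +-mono-≤ roots (≤-trans (words-length (dag S)) (*-monoˡ-≤ (#nodes S) (m≤m+n 3 49))) ,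
  ≤-trans (Sound.few sound) (*-monoˡ-≤ (#true ix) (m≤m+n 2 50)) ,
  Sound.unique sound ,
  λ A u v t →
  let r                            = pointer S (A , u , v) t
      (π , w , ℓ , n , d , ℓ<rank) = pointed sound A u v t
      ℓ<N                          = <-≤-trans ℓ<rank (rank≤N (W ix) u v)
      (L , search)                 = bfs r ⟨ tree d ⟩
      members                      = bfs-members search
  in
  r , to-witness-just (root S (A , u , v)) _ , π , w , denotes (tree d) , path (tree d) , generated d ,
  (λ inp scratch stores →
    Machine.relax inp extract (time B (length π) (bounded ℓ<N d))
      (Extract.extracting stores (tree d) scratch)) ,
  length L , (L , bfs-unique (dag S) search ([] ∷ []) , members , refl) ,
  SLP.slp ⟨ tree d ⟩ members , SLP.isSLP ⟨ tree d ⟩ members ,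
  λ inp scratch stores →
    Machine.relax inp compress (≤-reflexive (*-comm (length L) 52))
      (Compress.compressing stores ⟨ tree d ⟩ search scratch)
  where
  time : ∀ B k {n} → n ≤ B * suc k → n * 19 ≤ B * 19 * suc k
  time B k {n} n≤ = ≤-trans (*-monoˡ-≤ 19 n≤) (≤-reflexive (lemma B (suc k)))
    where
    lemma : ∀ B k → B * k * 19 ≡ B * 19 * k
    lemma = solve-∀
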